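{- Fix $p \in (0,1)$ (a constant independent of $n$). The following property holds asymptotically almost surely for $G = (V,E) \in \mathcal{G}(n,p)$: $$ \mathrm{pq}(G) = \Theta \big( \mathrm{eq}(G) \big) = \Theta ( \log n ). $$
   Context: Query game on a simple graph $G=(V,E)$: $d_G(u,v)$ denotes the graph distance. An adversary fixes a target vertex $v^*\in V$ unknown to an adaptive algorithm. In each round the algorithm queries two vertices $u,v$, and the adversary replies with whichever of $u,v$ is closer to $v^*$ (with either one, at the adversary's choice, if $d_G(u,v^*)=d_G(v,v^*)$). Equivalently: put $V_0=V$; in round $t$ the algorithm presents $(u_t,v_t)$ (depending on $G$ and earlier replies) and the adversary chooses either $V_t=\{x\in V_{t-1}: d_G(u_t,x)\le d_G(v_t,x)\}$ (reply $u_t$) or $V_t=\{x\in V_{t-1}: d_G(v_t,x)\le d_G(u_t,x)\}$ (reply $v_t$); the target is located once $|V_t|=1$. A pair query allows arbitrary $u,v\in V$; an edge query requires $u$ and $v$ to be adjacent. $\mathrm{pq}(G)$ (respectively $\mathrm{eq}(G)$) is the least integer $t$ such that the algorithm can locate the target in at most $t$ pair queries (respectively edge queries), regardless of the strategy of the adversary. $\mathcal{G}(n,p)$ is the binomial random graph on vertex set $\{1,\dots,n\}$, each pair being an edge independently with probability $p$. A property holds asymptotically almost surely (a.a.s.) if its probability tends to $1$ as $n\to\infty$. $\log$ is the natural logarithm; the constants hidden in $\Theta$ may depend on $p$. -}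

module Defs where

open import Data.Bool.Base using (Bool; true; false; T; if_then_else_)
open import Data.Fin.Base using (Fin; zero; suc)
open import Data.Integer.Base as ℤ using (ℤ)
import Data.Integer.Properties as ℤ
open import Data.List.Base using (List; []; _∷_; map; foldr; cartesianProductWith)
open import Data.Nat.Base as ℕ using (ℕ; zero; suc)
import Data.Nat.Properties as ℕ
open import Data.Nat.Coprimality using (1-coprimeTo) renaming (sym to coprime-sym)
open import Data.Nat.Solver using () renaming (module +-*-Solver to ℕ-Solver)
open import Data.Product.Base using (Σ-syntax; ∃-syntax; _×_; _,_)
open import Data.Product using (∃!)
open import Data.Rational.Base as ℚ using (ℚ; mkℚ; 0ℚ; 1ℚ; toℚᵘ)
import Data.Rational.Properties as ℚ
open import Data.Rational.Solver using () renaming (module +-*-Solver to ℚ-Solver)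
open import Data.Rational.Unnormalised.Base as ℚᵘ using (mkℚᵘ; *≡*)
import Data.Rational.Unnormalised.Properties as ℚᵘ
open import Data.Sum.Base using (inj₁; inj₂)
open import Data.Unit.Base using (⊤)
open import Data.Vec.Base using (Vec; []; _∷_; lookup)
open import Relation.Binary.PropositionalEquality
  using (_≡_; refl; sym; trans; cong; cong₂; subst)
open import Relation.Nullary using (¬_)

------------------------------------------------------------------------
-- Rational preliminaries

fromℕℚ : ℕ → ℚ
fromℕℚ n = mkℚ (ℤ.+ n) 0 (coprime-sym (1-coprimeTo n))

-- 1 / (k + 1)
recip : ℕ → ℚ
recip k = mkℚ (ℤ.+ 1) k (1-coprimeTo (suc k))

-- f 0 + ⋯ + f (n - 1)
sumℚ : ℕ → (ℕ → ℚ) → ℚ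
sumℚ zero    f = 0ℚ
sumℚ (suc n) f = sumℚ n f ℚ.+ f n

∣-∣-intro : ∀ {p q ε} → p ℚ.≤ q ℚ.+ ε → q ℚ.≤ p ℚ.+ ε → ℚ.∣ p ℚ.- q ∣ ℚ.≤ ε
∣-∣-intro {p} {q} {ε} p≤ q≤ with ℚ.∣p∣≡p∨∣p∣≡-p (p ℚ.- q)
... | inj₁ eq = begin
  ℚ.∣ p ℚ.- q ∣          ≡⟨ eq ⟩
  p ℚ.- q                ≤⟨ ℚ.+-monoˡ-≤ (ℚ.- q) p≤ ⟩
  q ℚ.+ ε ℚ.- q          ≡⟨ solve 2 (λ q ε → q :+ ε :- q := ε) refl q ε ⟩
  ε                      ∎
  where open ℚ.≤-Reasoning; open ℚ-Solver
... | inj₂ eq = begin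
  ℚ.∣ p ℚ.- q ∣          ≡⟨ eq ⟩
  ℚ.- (p ℚ.- q)          ≡⟨ solve 2 (λ p q → :- (p :- q) := q :- p) refl p q ⟩
  q ℚ.- p                ≤⟨ ℚ.+-monoˡ-≤ (ℚ.- p) q≤ ⟩
  p ℚ.+ ε ℚ.- p          ≡⟨ solve 2 (λ p ε → p :+ ε :- p := ε) refl p ε ⟩
  ε                      ∎
  where open ℚ.≤-Reasoning; open ℚ-Solver

half-pos : ∀ {ε} → 0ℚ ℚ.< ε → 0ℚ ℚ.< ℚ.½ ℚ.* ε
half-pos {ε} 0<ε = ℚ.positive⁻¹ (ℚ.½ ℚ.* ε)
  where instance
    _ = ℚ.positive 0<ε
    _ = ℚ.pos*pos⇒pos ℚ.½ ε

half+half : ∀ ε → ℚ.½ ℚ.* ε ℚ.+ ℚ.½ ℚ.* ε ≡ ε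
half+half ε = trans (sym (ℚ.*-distribʳ-+ ε ℚ.½ ℚ.½)) (ℚ.*-identityˡ ε)

------------------------------------------------------------------------
-- Real numbers, as Cauchy sequences of rationals; all operations are
-- termwise.  Two sequences represent the same real when neither is below
-- the other, so `≤ᴿ` and `<ᴿ` are relations between the represented reals.

Cauchy : (ℕ → ℚ) → Set
Cauchy x = ∀ ε → 0ℚ ℚ.< ε →
  ∃[ N ] (∀ m n → N ℕ.≤ m → N ℕ.≤ n → ℚ.∣ x m ℚ.- x n ∣ ℚ.≤ ε)

record ℝ : Set where
  constructor mkℝ
  field
    seq    : ℕ → ℚ
    cauchy : Cauchy seq
open ℝ public

infix  4 _<ᴿ_ _≤ᴿ_
infixl 6 _+ᴿ_ _-ᴿ_
infixl 7 _*ᴿ_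

_<ᴿ_ : ℝ → ℝ → Set
x <ᴿ y = Σ[ ε ∈ ℚ ] 0ℚ ℚ.< ε ×
  (∃[ N ] (∀ n → N ℕ.≤ n → seq x n ℚ.+ ε ℚ.≤ seq y n))

_≤ᴿ_ : ℝ → ℝ → Set
x ≤ᴿ y = ¬ (y <ᴿ x)

cauchy-+ : ∀ {x y} → Cauchy x → Cauchy y → Cauchy (λ n → x n ℚ.+ y n)
cauchy-+ {x} {y} cx cy ε 0<ε
  with cx (ℚ.½ ℚ.* ε) (half-pos 0<ε) | cy (ℚ.½ ℚ.* ε) (half-pos 0<ε)
... | N , hx | M , hy = N ℕ.⊔ M , λ m n m≥ n≥ → begin
  ℚ.∣ (x m ℚ.+ y m) ℚ.- (x n ℚ.+ y n) ∣
    ≡⟨ cong ℚ.∣_∣ (solve 4 (λ a b c d → a :+ b :- (c :+ d) := (a :- c) :+ (b :- d))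
         refl (x m) (y m) (x n) (y n)) ⟩
  ℚ.∣ (x m ℚ.- x n) ℚ.+ (y m ℚ.- y n) ∣
    ≤⟨ ℚ.∣p+q∣≤∣p∣+∣q∣ (x m ℚ.- x n) (y m ℚ.- y n) ⟩
  ℚ.∣ x m ℚ.- x n ∣ ℚ.+ ℚ.∣ y m ℚ.- y n ∣
    ≤⟨ ℚ.+-mono-≤ (hx m n (ℕ.m⊔n≤o⇒m≤o N M m≥) (ℕ.m⊔n≤o⇒m≤o N M n≥))
                  (hy m n (ℕ.m⊔n≤o⇒n≤o N M m≥) (ℕ.m⊔n≤o⇒n≤o N M n≥)) ⟩
  ℚ.½ ℚ.* ε ℚ.+ ℚ.½ ℚ.* ε
    ≡⟨ half+half ε ⟩
  ε ∎
  where open ℚ.≤-Reasoning; open ℚ-Solver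

cauchy-neg : ∀ {x} → Cauchy x → Cauchy (λ n → ℚ.- x n)
cauchy-neg {x} cx ε 0<ε with cx ε 0<ε
... | N , hx = N , λ m n m≥ n≥ → begin
  ℚ.∣ ℚ.- x m ℚ.- (ℚ.- x n) ∣
    ≡⟨ cong ℚ.∣_∣ (solve 2 (λ a b → (:- a) :- (:- b) := :- (a :- b)) refl (x m) (x n)) ⟩
  ℚ.∣ ℚ.- (x m ℚ.- x n) ∣  ≡⟨ ℚ.∣-p∣≡∣p∣ (x m ℚ.- x n) ⟩
  ℚ.∣ x m ℚ.- x n ∣        ≤⟨ hx m n m≥ n≥ ⟩
  ε ∎
  where open ℚ.≤-Reasoning; open ℚ-Solver

eventually-bounded : ∀ {x} → Cauchy x →
  Σ[ B ∈ ℚ ] 0ℚ ℚ.< B × (∃[ N ] (∀ n → N ℕ.≤ n → ℚ.∣ x n ∣ ℚ.≤ B))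
eventually-bounded {x} cx with cx 1ℚ (ℚ.positive⁻¹ 1ℚ)
... | N , hx = 1ℚ ℚ.+ ℚ.∣ x N ∣ , pos , N , λ n n≥ → begin
  ℚ.∣ x n ∣                      ≡⟨ cong ℚ.∣_∣ (solve 2 (λ a b → a := (a :- b) :+ b) refl (x n) (x N)) ⟩
  ℚ.∣ (x n ℚ.- x N) ℚ.+ x N ∣      ≤⟨ ℚ.∣p+q∣≤∣p∣+∣q∣ (x n ℚ.- x N) (x N) ⟩
  ℚ.∣ x n ℚ.- x N ∣ ℚ.+ ℚ.∣ x N ∣  ≤⟨ ℚ.+-monoˡ-≤ ℚ.∣ x N ∣ (hx n N n≥ ℕ.≤-refl) ⟩
  1ℚ ℚ.+ ℚ.∣ x N ∣               ∎
  where
  open ℚ.≤-Reasoning; open ℚ-Solver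
  pos : 0ℚ ℚ.< 1ℚ ℚ.+ ℚ.∣ x N ∣
  pos = ℚ.+-mono-<-≤ (ℚ.positive⁻¹ 1ℚ) (ℚ.0≤∣p∣ (x N))

product-bound : ∀ a b C D → 0ℚ ℚ.≤ D → ℚ.∣ a ∣ ℚ.≤ C → ℚ.∣ b ∣ ℚ.≤ D →
  ℚ.∣ a ℚ.* b ∣ ℚ.≤ C ℚ.* D
product-bound a b C D 0≤D a≤ b≤ = begin
  ℚ.∣ a ℚ.* b ∣          ≡⟨ ℚ.∣p*q∣≡∣p∣*∣q∣ a b ⟩
  ℚ.∣ a ∣ ℚ.* ℚ.∣ b ∣    ≤⟨ ℚ.*-monoˡ-≤-nonNeg ℚ.∣ a ∣ {{ℚ.∣-∣-nonNeg a}} b≤ ⟩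
  ℚ.∣ a ∣ ℚ.* D          ≤⟨ ℚ.*-monoʳ-≤-nonNeg D {{ℚ.nonNegative 0≤D}} a≤ ⟩
  C ℚ.* D                ∎
  where open ℚ.≤-Reasoning

divide : ∀ B ε → 0ℚ ℚ.< B → 0ℚ ℚ.< ε → Σ[ δ ∈ ℚ ] 0ℚ ℚ.< δ × B ℚ.* δ ≡ ε
divide B ε 0<B 0<ε =
  r ℚ.* ε , ℚ.positive⁻¹ (r ℚ.* ε) {{ℚ.pos*pos⇒pos r {{ℚ.1/pos⇒pos B}} ε}} ,
  trans (sym (ℚ.*-assoc B r ε))
    (trans (cong (ℚ._* ε) (ℚ.*-inverseʳ B)) (ℚ.*-identityˡ ε))
  where
  instance
    posB : ℚ.Positive B
    posB = ℚ.positive 0<B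
    nonZeroB : ℚ.NonZero B
    nonZeroB = ℚ.pos⇒nonZero B
    posε : ℚ.Positive ε
    posε = ℚ.positive 0<ε
  r : ℚ
  r = ℚ.1/ B

cauchy-* : ∀ {x y} → Cauchy x → Cauchy y → Cauchy (λ n → x n ℚ.* y n)
cauchy-* {x} {y} cx cy ε 0<ε =
  let A , 0<A , N₁ , hA = eventually-bounded {x} cx
      B , 0<B , N₂ , hB = eventually-bounded {y} cy
      δ , 0<δ , eq      = divide (A ℚ.+ B) ε (ℚ.+-mono-< 0<A 0<B) 0<ε
      N₃ , hx           = cx δ 0<δ
      N₄ , hy           = cy δ 0<δ
  in (N₁ ℕ.⊔ N₂) ℕ.⊔ (N₃ ℕ.⊔ N₄) , λ m n m≥ n≥ →
     let m≥₁₂ = ℕ.m⊔n≤o⇒m≤o (N₁ ℕ.⊔ N₂) (N₃ ℕ.⊔ N₄) m≥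
         m≥₃₄ = ℕ.m⊔n≤o⇒n≤o (N₁ ℕ.⊔ N₂) (N₃ ℕ.⊔ N₄) m≥
         n≥₁₂ = ℕ.m⊔n≤o⇒m≤o (N₁ ℕ.⊔ N₂) (N₃ ℕ.⊔ N₄) n≥
         n≥₃₄ = ℕ.m⊔n≤o⇒n≤o (N₁ ℕ.⊔ N₂) (N₃ ℕ.⊔ N₄) n≥
     in ℚ.≤-trans
          (difference (x m) (y m) (x n) (y n) A B δ (ℚ.<⇒≤ 0<δ)
            (hA m (ℕ.m⊔n≤o⇒m≤o N₁ N₂ m≥₁₂)) (hB n (ℕ.m⊔n≤o⇒n≤o N₁ N₂ n≥₁₂))
            (hx m n (ℕ.m⊔n≤o⇒m≤o N₃ N₄ m≥₃₄) (ℕ.m⊔n≤o⇒m≤o N₃ N₄ n≥₃₄))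
            (hy m n (ℕ.m⊔n≤o⇒n≤o N₃ N₄ m≥₃₄) (ℕ.m⊔n≤o⇒n≤o N₃ N₄ n≥₃₄)))
          (ℚ.≤-reflexive eq)
  where
  open ℚ.≤-Reasoning; open ℚ-Solver
  difference : ∀ a b c d A B δ → 0ℚ ℚ.≤ δ → ℚ.∣ a ∣ ℚ.≤ A → ℚ.∣ d ∣ ℚ.≤ B →
    ℚ.∣ a ℚ.- c ∣ ℚ.≤ δ → ℚ.∣ b ℚ.- d ∣ ℚ.≤ δ →
    ℚ.∣ a ℚ.* b ℚ.- c ℚ.* d ∣ ℚ.≤ (A ℚ.+ B) ℚ.* δ
  difference a b c d A B δ 0≤δ a≤ d≤ ac≤ bd≤ = begin
    ℚ.∣ a ℚ.* b ℚ.- c ℚ.* d ∣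
      ≡⟨ cong ℚ.∣_∣ (solve 4 (λ a b c d →
           a :* b :- c :* d := a :* (b :- d) :+ d :* (a :- c)) refl a b c d) ⟩
    ℚ.∣ a ℚ.* (b ℚ.- d) ℚ.+ d ℚ.* (a ℚ.- c) ∣
      ≤⟨ ℚ.∣p+q∣≤∣p∣+∣q∣ (a ℚ.* (b ℚ.- d)) (d ℚ.* (a ℚ.- c)) ⟩
    ℚ.∣ a ℚ.* (b ℚ.- d) ∣ ℚ.+ ℚ.∣ d ℚ.* (a ℚ.- c) ∣
      ≤⟨ ℚ.+-mono-≤ (product-bound a (b ℚ.- d) A δ 0≤δ a≤ bd≤)
                    (product-bound d (a ℚ.- c) B δ 0≤δ d≤ ac≤) ⟩
    A ℚ.* δ ℚ.+ B ℚ.* δ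
      ≡⟨ sym (ℚ.*-distribʳ-+ δ A B) ⟩
    (A ℚ.+ B) ℚ.* δ ∎

fromℚ : ℚ → ℝ
fromℚ q = mkℝ (λ _ → q) λ ε 0<ε → 0 , λ _ _ _ _ →
  subst (ℚ._≤ ε) (sym (cong ℚ.∣_∣ (ℚ.+-inverseʳ q))) (ℚ.<⇒≤ 0<ε)

fromℕ : ℕ → ℝ
fromℕ n = fromℚ (fromℕℚ n)

0ᴿ 1ᴿ : ℝ
0ᴿ = fromℚ 0ℚ
1ᴿ = fromℚ 1ℚ

_+ᴿ_ _-ᴿ_ _*ᴿ_ : ℝ → ℝ → ℝ
x +ᴿ y = mkℝ (λ n → seq x n ℚ.+ seq y n) (cauchy-+ {seq x} {seq y} (cauchy x) (cauchy y))
x -ᴿ y = mkℝ (λ n → seq x n ℚ.- seq y n)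
  (cauchy-+ {seq x} {λ n → ℚ.- seq y n} (cauchy x) (cauchy-neg {seq y} (cauchy y)))
x *ᴿ y = mkℝ (λ n → seq x n ℚ.* seq y n) (cauchy-* {seq x} {seq y} (cauchy x) (cauchy y))

_⟶_ : (ℕ → ℝ) → ℝ → Set
x ⟶ L = ∀ ε → 0ᴿ <ᴿ ε →
  ∃[ N ] (∀ n → N ℕ.≤ n → (L -ᴿ ε <ᴿ x n) × (x n <ᴿ L +ᴿ ε))

------------------------------------------------------------------------
-- The natural logarithm of n ≥ 1, as the integral of 1/t over [1 , n].
-- With K = suc k steps per unit the i-th right endpoint is
-- t = 1 + (i + 1) / K, so that the right Riemann sum is
--
--   Σ_{i < (n - 1) K} (1 / K) (1 / t)  =  Σ_{i < (n - 1) K} 1 / (K + i + 1).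

harmonic : ℕ → ℕ → ℚ
harmonic a N = sumℚ N (λ i → recip (a ℕ.+ i))

logSeq : ℕ → ℕ → ℚ
logSeq n k = harmonic (suc k) ((n ℕ.∸ 1) ℕ.* suc k)

recip-pos : ∀ k → 0ℚ ℚ.< recip k
recip-pos k = ℚ.positive⁻¹ (recip k)

recip-anti : ∀ {a b} → a ℕ.≤ b → recip b ℚ.≤ recip a
recip-anti {a} {b} a≤b = ℚ.*≤* (ℤ.*-monoˡ-≤-nonNeg (ℤ.+ 1) (ℤ.+≤+ (ℕ.s≤s a≤b)))

archimedean : ∀ ε → 0ℚ ℚ.< ε → ∃[ N ] recip N ℚ.≤ ε
archimedean ε@(mkℚ (ℤ.+ zero) d _) 0<ε with ℚ.positive {ε} 0<ε
... | ()
archimedean (mkℚ ℤ.+[1+ a ] d _) _ = d ,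
  ℚ.*≤* (ℤ.*-monoʳ-≤-nonNeg (ℤ.+ suc d) (ℤ.+≤+ {1} {suc a} (ℕ.s≤s ℕ.z≤n)))
archimedean ε@(mkℚ ℤ.-[1+ _ ] d _) 0<ε with ℚ.positive {ε} 0<ε
... | ()

sumℚ-mono : ∀ n {f g} → (∀ i → i ℕ.< n → f i ℚ.≤ g i) → sumℚ n f ℚ.≤ sumℚ n g
sumℚ-mono zero    h = ℚ.≤-refl
sumℚ-mono (suc n) h =
  ℚ.+-mono-≤ (sumℚ-mono n (λ i i<n → h i (ℕ.m<n⇒m<1+n i<n))) (h n ℕ.≤-refl)

fromℕℚ-suc : ∀ n → fromℕℚ (suc n) ≡ fromℕℚ n ℚ.+ 1ℚ
fromℕℚ-suc n = ℚ.toℚᵘ-injective (ℚᵘ.≃-trans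
  (*≡* (trans (ℤ.*-identityʳ (ℤ.+ suc n)) (sym (trans (ℤ.*-identityʳ _)
    (trans (cong (ℤ._+ ℤ.+ 1) (ℤ.*-identityʳ (ℤ.+ n))) (cong ℤ.+_ (ℕ.+-comm n 1)))))))
  (ℚᵘ.≃-sym (ℚ.toℚᵘ-homo-+ (fromℕℚ n) 1ℚ)))

sumℚ-const : ∀ n c → sumℚ n (λ _ → c) ≡ fromℕℚ n ℚ.* c
sumℚ-const zero    c = sym (ℚ.*-zeroˡ c)
sumℚ-const (suc n) c = begin-equality
  sumℚ n (λ _ → c) ℚ.+ c      ≡⟨ cong (ℚ._+ c) (sumℚ-const n c) ⟩
  fromℕℚ n ℚ.* c ℚ.+ c        ≡⟨ solve 2 (λ a c → a :* c :+ c := (a :+ con 1ℚ) :* c) refl (fromℕℚ n) c ⟩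
  (fromℕℚ n ℚ.+ 1ℚ) ℚ.* c     ≡⟨ cong (ℚ._* c) (sym (fromℕℚ-suc n)) ⟩
  fromℕℚ (suc n) ℚ.* c        ∎
  where open ℚ.≤-Reasoning; open ℚ-Solver

recip-split : ∀ r m → fromℕℚ (suc m) ℚ.* recip (m ℕ.+ r ℕ.* suc m) ≡ recip r
recip-split r m = ℚ.toℚᵘ-injective (ℚᵘ.≃-trans
  (ℚ.toℚᵘ-homo-* (fromℕℚ (suc m)) (recip (m ℕ.+ r ℕ.* suc m)))
  (*≡* (cong ℤ.+_
    (solve 2 (λ m r → (con 1 :+ m) :* con 1 :* (con 1 :+ r)
        := con 1 :* (con 1 :* (con 1 :+ (m :+ r :* (con 1 :+ m))))) refl m r))))
  where open ℕ-Solver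

harmonic-+ : ∀ a N M → harmonic a (N ℕ.+ M) ≡ harmonic a N ℚ.+ harmonic (a ℕ.+ N) M
harmonic-+ a N zero = trans (cong (harmonic a) (ℕ.+-identityʳ N)) (sym (ℚ.+-identityʳ _))
harmonic-+ a N (suc M) = begin-equality
  harmonic a (N ℕ.+ suc M)
    ≡⟨ cong (harmonic a) (ℕ.+-suc N M) ⟩
  harmonic a (N ℕ.+ M) ℚ.+ recip (a ℕ.+ (N ℕ.+ M))
    ≡⟨ cong₂ ℚ._+_ (harmonic-+ a N M) (cong recip (sym (ℕ.+-assoc a N M))) ⟩
  (harmonic a N ℚ.+ harmonic (a ℕ.+ N) M) ℚ.+ recip (a ℕ.+ N ℕ.+ M)
    ≡⟨ ℚ.+-assoc (harmonic a N) (harmonic (a ℕ.+ N) M) (recip (a ℕ.+ N ℕ.+ M)) ⟩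
  harmonic a N ℚ.+ harmonic (a ℕ.+ N) (suc M) ∎
  where open ℚ.≤-Reasoning

harmonic-telescope : ∀ k N →
  harmonic k N ℚ.+ recip (k ℕ.+ N) ≡ recip k ℚ.+ harmonic (suc k) N
harmonic-telescope k zero = trans (ℚ.+-comm 0ℚ (recip (k ℕ.+ 0)))
  (cong (λ z → recip z ℚ.+ 0ℚ) (ℕ.+-identityʳ k))
harmonic-telescope k (suc N) = begin-equality
  (harmonic k N ℚ.+ recip (k ℕ.+ N)) ℚ.+ recip (k ℕ.+ suc N)
    ≡⟨ cong₂ ℚ._+_ (harmonic-telescope k N) (cong recip (ℕ.+-suc k N)) ⟩
  (recip k ℚ.+ harmonic (suc k) N) ℚ.+ recip (suc k ℕ.+ N)
    ≡⟨ ℚ.+-assoc (recip k) (harmonic (suc k) N) (recip (suc k ℕ.+ N)) ⟩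
  recip k ℚ.+ harmonic (suc k) (suc N) ∎
  where open ℚ.≤-Reasoning

right-refine : ∀ a N m → harmonic a N ℚ.≤ harmonic (a ℕ.* suc m) (N ℕ.* suc m)
right-refine a zero    m = ℚ.≤-refl
right-refine a (suc N) m = begin
  harmonic a N ℚ.+ recip (a ℕ.+ N)
    ≤⟨ ℚ.+-mono-≤ (right-refine a N m) block ⟩
  harmonic (a ℕ.* M) (N ℕ.* M) ℚ.+ harmonic (a ℕ.* M ℕ.+ N ℕ.* M) M
    ≡⟨ sym (harmonic-+ (a ℕ.* M) (N ℕ.* M) M) ⟩
  harmonic (a ℕ.* M) (N ℕ.* M ℕ.+ M)
    ≡⟨ cong (harmonic (a ℕ.* M)) (ℕ.+-comm (N ℕ.* M) M) ⟩
  harmonic (a ℕ.* M) (suc N ℕ.* M) ∎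
  where
  open ℚ.≤-Reasoning
  M : ℕ
  M = suc m
  block : recip (a ℕ.+ N) ℚ.≤ harmonic (a ℕ.* M ℕ.+ N ℕ.* M) M
  block = begin
    recip (a ℕ.+ N)
      ≡⟨ sym (recip-split (a ℕ.+ N) m) ⟩
    fromℕℚ M ℚ.* recip (m ℕ.+ (a ℕ.+ N) ℕ.* M)
      ≡⟨ sym (sumℚ-const M _) ⟩
    sumℚ M (λ _ → recip (m ℕ.+ (a ℕ.+ N) ℕ.* M))
      ≤⟨ sumℚ-mono M (λ j j<M → recip-anti (begin′ j j<M)) ⟩
    harmonic (a ℕ.* M ℕ.+ N ℕ.* M) M ∎
    where
    begin′ : ∀ j → j ℕ.< M → a ℕ.* M ℕ.+ N ℕ.* M ℕ.+ j ℕ.≤ m ℕ.+ (a ℕ.+ N) ℕ.* M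
    begin′ j j<M = subst (ℕ._≤ m ℕ.+ (a ℕ.+ N) ℕ.* M)
      (trans (ℕ.+-comm j _) (cong (ℕ._+ j) (ℕ.*-distribʳ-+ M a N)))
      (ℕ.+-monoˡ-≤ ((a ℕ.+ N) ℕ.* M) (ℕ.s≤s⁻¹ j<M))

left-refine : ∀ k N m → harmonic (m ℕ.+ k ℕ.* suc m) (N ℕ.* suc m) ℚ.≤ harmonic k N
left-refine k zero    m = ℚ.≤-refl
left-refine k (suc N) m = begin
  harmonic a (suc N ℕ.* M)
    ≡⟨ cong (harmonic a) (ℕ.+-comm M (N ℕ.* M)) ⟩
  harmonic a (N ℕ.* M ℕ.+ M)
    ≡⟨ harmonic-+ a (N ℕ.* M) M ⟩
  harmonic a (N ℕ.* M) ℚ.+ harmonic (a ℕ.+ N ℕ.* M) M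
    ≤⟨ ℚ.+-mono-≤ (left-refine k N m) block ⟩
  harmonic k N ℚ.+ recip (k ℕ.+ N) ∎
  where
  open ℚ.≤-Reasoning
  M a : ℕ
  M = suc m
  a = m ℕ.+ k ℕ.* M
  block : harmonic (a ℕ.+ N ℕ.* M) M ℚ.≤ recip (k ℕ.+ N)
  block = begin
    harmonic (a ℕ.+ N ℕ.* M) M
      ≤⟨ sumℚ-mono M (λ j _ → recip-anti (ℕ.m≤m+n (a ℕ.+ N ℕ.* M) j)) ⟩
    sumℚ M (λ _ → recip (a ℕ.+ N ℕ.* M))
      ≡⟨ sumℚ-const M _ ⟩
    fromℕℚ M ℚ.* recip (a ℕ.+ N ℕ.* M)
      ≡⟨ cong (λ z → fromℕℚ M ℚ.* recip z)
           (trans (ℕ.+-assoc m (k ℕ.* M) (N ℕ.* M))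
                  (cong (m ℕ.+_) (sym (ℕ.*-distribʳ-+ M k N)))) ⟩
    fromℕℚ M ℚ.* recip (m ℕ.+ (k ℕ.+ N) ℕ.* M)
      ≡⟨ recip-split (k ℕ.+ N) m ⟩
    recip (k ℕ.+ N) ∎

logSeq-close : ∀ n k m → logSeq n k ℚ.≤ logSeq n m ℚ.+ recip m
logSeq-close n k m = begin
  harmonic K (s ℕ.* K)
    ≤⟨ right-refine K (s ℕ.* K) m ⟩
  harmonic (K ℕ.* M) (s ℕ.* K ℕ.* M)
    ≡⟨ cong₂ harmonic (ℕ.*-comm K M)
         (trans (ℕ.*-assoc s K M) (trans (cong (s ℕ.*_) (ℕ.*-comm K M)) (sym (ℕ.*-assoc s M K)))) ⟩
  harmonic (M ℕ.* K) (s ℕ.* M ℕ.* K)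
    ≤⟨ sumℚ-mono (s ℕ.* M ℕ.* K) (λ i _ → recip-anti (ℕ.n≤1+n (k ℕ.+ m ℕ.* K ℕ.+ i))) ⟩
  harmonic (k ℕ.+ m ℕ.* K) (s ℕ.* M ℕ.* K)
    ≤⟨ left-refine m (s ℕ.* M) k ⟩
  harmonic m (s ℕ.* M)
    ≡⟨ sym (ℚ.+-identityʳ _) ⟩
  harmonic m (s ℕ.* M) ℚ.+ 0ℚ
    ≤⟨ ℚ.+-monoʳ-≤ (harmonic m (s ℕ.* M)) (ℚ.<⇒≤ (recip-pos (m ℕ.+ s ℕ.* M))) ⟩
  harmonic m (s ℕ.* M) ℚ.+ recip (m ℕ.+ s ℕ.* M)
    ≡⟨ harmonic-telescope m (s ℕ.* M) ⟩
  recip m ℚ.+ harmonic M (s ℕ.* M)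
    ≡⟨ ℚ.+-comm (recip m) (harmonic M (s ℕ.* M)) ⟩
  harmonic M (s ℕ.* M) ℚ.+ recip m ∎
  where
  open ℚ.≤-Reasoning
  K M s : ℕ
  K = suc k
  M = suc m
  s = n ℕ.∸ 1

logSeq-cauchy : ∀ n → Cauchy (logSeq n)
logSeq-cauchy n ε 0<ε with archimedean ε 0<ε
... | N , h = N , λ k m k≥ m≥ → ∣-∣-intro {logSeq n k} {logSeq n m}
  (close k m m≥) (close m k k≥)
  where
  close : ∀ k m → N ℕ.≤ m → logSeq n k ℚ.≤ logSeq n m ℚ.+ ε
  close k m m≥ = ℚ.≤-trans (logSeq-close n k m)
    (ℚ.+-monoʳ-≤ (logSeq n m) (ℚ.≤-trans (recip-anti m≥) h))

-- Junk value: log 0 = 0.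
log : ℕ → ℝ
log n = mkℝ (logSeq n) (logSeq-cauchy n)

------------------------------------------------------------------------
-- Simple graphs on n vertices and graph distance

record SimpleGraph (n : ℕ) : Set where
  field
    adj        : Fin n → Fin n → Bool
    adj-sym    : ∀ u v → adj u v ≡ adj v u
    adj-irrefl : ∀ u → adj u u ≡ false
open SimpleGraph public

module _ {n : ℕ} (G : SimpleGraph n) where

  Adjacent : Fin n → Fin n → Set
  Adjacent u v = T (adj G u v)

  data Walk : ℕ → Fin n → Fin n → Set where
    []  : ∀ {u} → Walk 0 u u
    _∷_ : ∀ {k u v w} → Adjacent u v → Walk k v w → Walk (suc k) u w

  -- d(u , v) = k; there is no such k when u and v are in different
  -- components, where d(u , v) = ∞.
  IsDist : Fin n → Fin n → ℕ → Set
  IsDist u v k = Walk k u v × (∀ j → j ℕ.< k → ¬ Walk j u v)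

  -- d(u , x) ≤ d(v , x) in ℕ ∪ {∞}
  Closer : Fin n → Fin n → Fin n → Set
  Closer u v x = ∀ k → IsDist v x k → ∃[ j ] (IsDist u x j × j ℕ.≤ k)

------------------------------------------------------------------------
-- The query game.  `Query u v` says which queries are allowed.

  module Game (Query : Fin n → Fin n → Set) where

    -- An adaptive algorithm making at most t queries: the continuations
    -- follow the replies u and v respectively.
    data Algorithm : ℕ → Set where
      stop : ∀ {t} → Algorithm t
      ask  : ∀ {t} (u v : Fin n) → Query u v →
             Algorithm t → Algorithm t → Algorithm (suc t)

    -- Started from the candidate set V, the algorithm ends with exactly
    -- one candidate whatever legal replies are given for this target.
    Locates : ∀ {t} → (target : Fin n) → (V : Fin n → Set) → Algorithm t → Set
    Locates target V stop = ∃! _≡_ V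
    Locates target V (ask u v _ ifU ifV) =
      (Closer u v target → Locates target (λ x → V x × Closer u v x) ifU) ×
      (Closer v u target → Locates target (λ x → V x × Closer v u x) ifV)

    Solvable : ℕ → Set
    Solvable t = Σ[ A ∈ Algorithm t ] (∀ target → Locates target (λ _ → ⊤) A)

    IsLeast : ℕ → Set
    IsLeast t = Solvable t × (∀ s → Solvable s → t ℕ.≤ s)

  -- pq(G) = t.
  IsPq : ℕ → Set
  IsPq = Game.IsLeast (λ _ _ → ⊤)

  -- eq(G) = t; there is no such t when edge queries never suffice.
  IsEq : ℕ → Set
  IsEq = Game.IsLeast Adjacent

------------------------------------------------------------------------
-- The binomial random graph G(n , p)

-- One coin per unordered pair of vertices: for n + 1 vertices, the coins
-- of the pairs {0 , j + 1}, and the coins of the remaining n vertices.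
data Coins : ℕ → Set where
  []  : Coins 0
  _∷_ : ∀ {n} → Vec Bool n → Coins n → Coins (suc n)

coinAt : ∀ {n} → Coins n → Fin n → Fin n → Bool
coinAt (r ∷ c) zero    zero    = false
coinAt (r ∷ c) zero    (suc j) = lookup r j
coinAt (r ∷ c) (suc i) zero    = lookup r i
coinAt (r ∷ c) (suc i) (suc j) = coinAt c i j

coinAt-sym : ∀ {n} (c : Coins n) u v → coinAt c u v ≡ coinAt c v u
coinAt-sym (r ∷ c) zero    zero    = refl
coinAt-sym (r ∷ c) zero    (suc j) = refl
coinAt-sym (r ∷ c) (suc i) zero    = refl
coinAt-sym (r ∷ c) (suc i) (suc j) = coinAt-sym c i j

coinAt-irrefl : ∀ {n} (c : Coins n) u → coinAt c u u ≡ false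
coinAt-irrefl (r ∷ c) zero    = refl
coinAt-irrefl (r ∷ c) (suc i) = coinAt-irrefl c i

graph : ∀ {n} → Coins n → SimpleGraph n
graph c = record
  { adj        = coinAt c
  ; adj-sym    = coinAt-sym c
  ; adj-irrefl = coinAt-irrefl c
  }

allVecs : ∀ n → List (Vec Bool n)
allVecs zero    = [] ∷ []
allVecs (suc n) = cartesianProductWith _∷_ (true ∷ false ∷ []) (allVecs n)

allCoins : ∀ n → List (Coins n)
allCoins zero    = [] ∷ []
allCoins (suc n) = cartesianProductWith _∷_ (allVecs n) (allCoins n)

massVec : ∀ {n} → ℝ → Vec Bool n → ℝ
massVec p []          = 1ᴿ
massVec p (true  ∷ r) = p *ᴿ massVec p r
massVec p (false ∷ r) = (1ᴿ -ᴿ p) *ᴿ massVec p r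

mass : ∀ {n} → ℝ → Coins n → ℝ
mass p []      = 1ᴿ
mass p (r ∷ c) = massVec p r *ᴿ mass p c

Pr : ∀ {n} → ℝ → (Coins n → Bool) → ℝ
Pr {n} p S = foldr _+ᴿ_ 0ᴿ (map (λ c → if S c then mass p c else 0ᴿ) (allCoins n))

-- The property P of the random graph holds a.a.s.  A probability can only
-- be assigned to a decidable event, while P need not be decidable, so this
-- asks for decidable events implying P whose probabilities tend to 1.
-- Classically one can take the event P itself.
AAS : ℝ → (∀ n → SimpleGraph n → Set) → Set
AAS p P = Σ[ S ∈ (∀ n → Coins n → Bool) ]
  (∀ n c → T (S n c) → P n (graph c)) × ((λ n → Pr p (S n)) ⟶ 1ᴿ)

------------------------------------------------------------------------

-- c y ≤ x ≤ C y
Between : ℝ → ℝ → ℝ → ℝ → Set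
Between c C y x = (c *ᴿ y ≤ᴿ x) × (x ≤ᴿ C *ᴿ y)

-- Upper bound: if u ~ v, u ~ x ≁ v and v ~ y ≁ u, then either reply to the
-- query (u , v) eliminates y or x, so a list of edges among which every two
-- vertices are separated in this way locates the target without adaptivity.
-- A given pair {u , v} does this with probability p³(1 - p)², independently for
-- disjoint pairs avoiding x and y; hence of Θ(log n) fixed disjoint pairs some
-- pair separates x and y except with probability o(n⁻²), and a union bound
-- over x and y applies.  Separation also bounds the diameter by 3, which
-- makes the game decidable, so that the least numbers of queries exist.
--
-- Lower bound: t pair queries have at most 2ᵗ sequences of replies, and
-- different targets need different ones, so n ≤ 2ᵗ.

module Submission where

open import Defs
open import Data.Bool.Base using (Bool; true; false; T; not; _∧_; _∨_; if_then_else_)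
open import Data.Bool.ListAction using (all; any)
import Data.Bool.Properties as Bool
open import Data.Fin.Base using (Fin; zero; suc; toℕ)
open import Data.Fin.Properties using (_≟_; any?; all?; toℕ-fromℕ<)
import Data.Integer.Base as ℤ
import Data.Integer.Properties as ℤ
open import Data.List.Base
  using (List; []; _∷_; _++_; length; map; foldr; filter; cartesianProductWith; cartesianProduct; allFin)
open import Data.List.Membership.Propositional.Properties using (∈-cartesianProduct⁺; ∈-allFin)
open import Data.List.Properties using (length-++; length-map; length-tabulate)
open import Data.List.Relation.Unary.All as All using (All; []; _∷_)
import Data.List.Relation.Unary.All.Properties as All
open import Data.List.Relation.Unary.AllPairs using (AllPairs; []; _∷_)
open import Data.List.Relation.Unary.Any using (Any; here; there; satisfied)
import Data.List.Relation.Unary.Any.Properties as Any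
open import Data.List.Relation.Unary.Unique.Propositional using (Unique)
import Data.List.Relation.Unary.Unique.Propositional.Properties as Unique
open import Data.Nat.Base as ℕ using (ℕ; zero; suc; z≤n; s≤s; _^_)
open import Data.Nat.Divisibility using (n∣m*n)
open import Data.Nat.DivMod
  using (_%_; _/_; _mod_; m<n⇒m%n≡m; m<n⇒m/n≡0; [m+kn]%n≡m%n; +-distrib-/-∣ʳ; m*n/n≡m)
import Data.Nat.Properties as ℕ
open import Data.Nat.Solver using () renaming (module +-*-Solver to ℕ-Solver)
open import Data.Product.Base using (Σ-syntax; ∃-syntax; _×_; _,_; proj₁; proj₂)
open import Data.Rational.Base as ℚ
  using (ℚ; 0ℚ; 1ℚ; ½; _+_; _*_; _-_; _≤_; _<_; NonNegative; nonNegative)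
import Data.Rational.Properties as ℚ
open import Data.Rational.Solver using () renaming (module +-*-Solver to ℚ-Solver)
open import Data.Sum.Base using (_⊎_; inj₁; inj₂)
open import Data.Unit.Base using (⊤; tt)
open import Data.Vec.Base using (Vec; []; _∷_; lookup)
open import Function.Base using (_∘_; id; case_of_)
open import Relation.Binary.PropositionalEquality
  using (_≡_; _≢_; refl; sym; trans; cong; cong₂; subst; ≢-sym; module ≡-Reasoning)
open import Relation.Nullary using (¬_; Dec; yes; no; contradiction; does)
open import Relation.Nullary.Decidable using (map′; _×-dec_; _→-dec_; _⊎-dec_; ¬?)
open import Relation.Unary using (Decidable)

-- The query game

-- Operations on reals are termwise, so the k-th term of a probability is the probability for coins
-- of rational bias `seq p k`, and all estimates are made over the rationals, one bias at a time.
-- However, neither the event nor the n from which its probability is close to 1 may depend on k.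
-- Therefore 0 < p < 1 is first turned into one number `N₀` such that 1/(N₀ + 1) is at most p³(1 -
-- p)² for all late terms of `p`; the number of pairs, the event and the constants depend on `p`
-- only through `N₀`. The event is a Boolean condition on the coins alone, which says that every two
-- vertices are separated; the numbers pq and eq have to be produced only where it holds.

least : {P : ℕ → Set} → Decidable P → ∀ s → P s →
  ∃[ t ] P t × t ℕ.≤ s × (∀ j → j ℕ.< t → ¬ P j)
least P? zero    Ps = 0 , Ps , z≤n , λ _ ()
least P? (suc s) Ps with P? 0
... | yes P0 = 0 , P0 , z≤n , λ _ ()
... | no ¬P0 with t , Pt , t≤s , min ← least (P? ∘ suc) s Ps =
  suc t , Pt , s≤s t≤s , λ { zero _ → ¬P0 ; (suc j) (s≤s j<t) → min j j<t }

length-filter-∁ : {A : Set} {P : A → Set} (P? : Decidable P) (xs : List A) →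
  length (filter P? xs) ℕ.+ length (filter (¬? ∘ P?) xs) ≡ length xs
length-filter-∁ P? []       = refl
length-filter-∁ P? (x ∷ xs) with P? x
... | yes _ = cong suc (length-filter-∁ P? xs)
... | no  _ = trans (ℕ.+-suc _ _) (cong suc (length-filter-∁ P? xs))

module _ {n : ℕ} (G : SimpleGraph n) where

  Adjacent-sym : ∀ {u v} → Adjacent G u v → Adjacent G v u
  Adjacent-sym {u} {v} = subst T (adj-sym G u v)

  Adjacent-irrefl : ∀ {u} → ¬ Adjacent G u u
  Adjacent-irrefl {u} = subst T (adj-irrefl G u)

  walk? : ∀ k u v → Dec (Walk G k u v)
  walk? zero    u v = map′ (λ { refl → [] }) (λ { [] → refl }) (u ≟ v)
  walk? (suc k) u w = map′ (λ (_ , e , es) → e ∷ es) (λ { (e ∷ es) → _ , e , es })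
    (any? λ v → Bool.T? (adj G u v) ×-dec walk? k v w)

  dist-unique : ∀ {u v j k} → IsDist G u v j → IsDist G u v k → j ≡ k
  dist-unique {j = j} {k} (wⱼ , minⱼ) (wₖ , minₖ) =
    ℕ.≤-antisym (ℕ.≮⇒≥ λ k<j → minⱼ k k<j wₖ) (ℕ.≮⇒≥ λ j<k → minₖ j j<k wⱼ)

  adjacent⇒dist1 : ∀ {u x} → Adjacent G u x → IsDist G u x 1
  adjacent⇒dist1 e = e ∷ [] , λ { 0 _ [] → Adjacent-irrefl e ; (suc _) (s≤s ()) }

  -- At distance 1 from `u`, the vertex `x` could be as close to `v` only by being `v` or a
  -- neighbour of `v`.
  not-closer : ∀ {u v x} → Adjacent G u x → v ≢ x → ¬ Adjacent G v x → ¬ Closer G v u x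
  not-closer u~x v≢x v≁x closer with closer 1 (adjacent⇒dist1 u~x)
  ... | 0 , ([] , _) , _           = v≢x refl
  ... | 1 , (e ∷ [] , _) , _       = v≁x e
  ... | suc (suc _) , _ , s≤s ()

  -- The inequalities do not follow from the non-adjacencies, because no vertex is adjacent to
  -- itself.
  Separates : Fin n → Fin n → Fin n × Fin n → Set
  Separates x y (u , v) = Adjacent G u v ×
    (Adjacent G u x × v ≢ x × ¬ Adjacent G v x) ×
    (Adjacent G v y × u ≢ y × ¬ Adjacent G u y)

  module _ {Query : Fin n → Fin n → Set} where
    open Game G Query

    Queries : Set
    Queries = List (Σ[ (u , v) ∈ Fin n × Fin n ] Query u v)

    nonadaptive : (qs : Queries) → Algorithm (length qs)
    nonadaptive []                   = stop
    nonadaptive (((u , v) , q) ∷ qs) = ask u v q (nonadaptive qs) (nonadaptive qs)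

    -- Both replies are covered, since at a tie the adversary may give either one to the target `x`.
    Distinguishes : Fin n → Fin n → Σ[ (u , v) ∈ Fin n × Fin n ] Query u v → Set
    Distinguishes x y ((u , v) , _) =
      (Closer G u v x → ¬ Closer G u v y) × (Closer G v u x → ¬ Closer G v u y)

    -- The invariant is that each surviving wrong candidate has a distinguishing query still to
    -- come. If the present query is the one, either legal reply removes that candidate.
    nonadaptive-locates : ∀ target V qs → V target →
      (∀ y → y ≢ target → V y → Any (Distinguishes target y) qs) →
      Locates target V (nonadaptive qs)
    nonadaptive-locates x V [] Vx dist = x , Vx , unique
      where
      unique : ∀ {y} → V y → x ≡ y
      unique {y} Vy with x ≟ y
      ... | yes x≡y = x≡y
      ... | no  x≢y = case dist y (x≢y ∘ sym) Vy of λ ()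
    nonadaptive-locates x V (((u , v) , _) ∷ qs) Vx dist =
      (λ closer → nonadaptive-locates x _ qs (Vx , closer) λ y y≢x (Vy , closer-y) →
        case dist y y≢x Vy of λ
          { (here (d , _)) → contradiction closer-y (d closer) ; (there later) → later }) ,
      (λ closer → nonadaptive-locates x _ qs (Vx , closer) λ y y≢x (Vy , closer-y) →
        case dist y y≢x Vy of λ
          { (here (_ , d)) → contradiction closer-y (d closer) ; (there later) → later })

    nonadaptive-solves : ∀ qs → (∀ x y → x ≢ y → Any (Distinguishes x y) qs) →
      Solvable (length qs)
    nonadaptive-solves qs dist = nonadaptive qs , λ x →
      nonadaptive-locates x _ qs tt λ y y≢x _ → dist x y (y≢x ∘ sym)

  edgesAmong : List (Fin n × Fin n) → Queries {Adjacent G}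
  edgesAmong [] = []
  edgesAmong ((u , v) ∷ qs) with Bool.T? (adj G u v)
  ... | yes e = ((u , v) , e) ∷ edgesAmong qs
  ... | no  _ = edgesAmong qs

  length-edgesAmong : ∀ qs → length (edgesAmong qs) ℕ.≤ length qs
  length-edgesAmong [] = z≤n
  length-edgesAmong ((u , v) ∷ qs) with Bool.T? (adj G u v)
  ... | yes _ = s≤s (length-edgesAmong qs)
  ... | no  _ = ℕ.m≤n⇒m≤1+n (length-edgesAmong qs)

  -- For the target `x` only the reply `u` is legal, and that reply eliminates `y`.
  separates⇒distinguishes : ∀ {x y} qs →
    Any (Separates x y) qs → Any (Distinguishes x y) (edgesAmong qs)
  separates⇒distinguishes ((u , v) ∷ qs) any with Bool.T? (adj G u v) | any
  ... | yes _ | here (_ , (u~x , v≢x , v≁x) , (v~y , u≢y , u≁y)) =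
    here ((λ _ → not-closer v~y u≢y u≁y) , λ cl → contradiction cl (not-closer u~x v≢x v≁x))
  ... | yes _ | there later      = there (separates⇒distinguishes qs later)
  ... | no ¬e | here (e , _)     = contradiction e ¬e
  ... | no _  | there later      = separates⇒distinguishes qs later

  edge⇒pair : ∀ {t} → Game.Solvable G (Adjacent G) t → Game.Solvable G (λ _ _ → ⊤) t
  edge⇒pair (A , locates) = forget A , λ x → forget-locates x _ A (locates x)
    where
    module E = Game G (Adjacent G)
    module P = Game G (λ _ _ → ⊤)
    forget : ∀ {t} → E.Algorithm t → P.Algorithm t
    forget E.stop          = P.stop
    forget (E.ask u v _ A B) = P.ask u v tt (forget A) (forget B)
    forget-locates : ∀ {t} x V (A : E.Algorithm t) → E.Locates x V A → P.Locates x V (forget A)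
    forget-locates x V E.stop loc = loc
    forget-locates x V (E.ask u v _ A B) (locA , locB) =
      (λ cl → forget-locates x _ A (locA cl)) , (λ cl → forget-locates x _ B (locB cl))

  -- Decidability of the game, and counting of replies, when all distances are finite

  module _ (dist : ∀ u v → ∃[ k ] IsDist G u v k) where

    closer : ∀ u v x → proj₁ (dist u x) ℕ.≤ proj₁ (dist v x) → Closer G u v x
    closer u v x du≤dv k dv =
      proj₁ (dist u x) , proj₂ (dist u x) ,
      subst (_ ℕ.≤_) (dist-unique (proj₂ (dist v x)) dv) du≤dv

    closer⁻¹ : ∀ u v x → Closer G u v x → proj₁ (dist u x) ℕ.≤ proj₁ (dist v x)
    closer⁻¹ u v x cl with j , d , j≤ ← cl _ (proj₂ (dist v x)) =
      subst (ℕ._≤ _) (dist-unique d (proj₂ (dist u x))) j≤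

    closer? : ∀ u v x → Dec (Closer G u v x)
    closer? u v x = map′ (closer u v x) (closer⁻¹ u v x)
      (proj₁ (dist u x) ℕ.≤? proj₁ (dist v x))

    closer-total : ∀ u v x → ¬ Closer G u v x → Closer G v u x
    closer-total u v x ¬cl = closer v u x (ℕ.≰⇒≥ (¬cl ∘ closer u v x))

    module _ {Query : Fin n → Fin n → Set} (query? : ∀ u v → Dec (Query u v)) where
      open Game G Query

      module _ {V : Fin n → Set} where

        ∃!? : Decidable V → Dec (∃[ x ] V x × (∀ {y} → V y → x ≡ y))
        ∃!? V? = any? λ x → V? x ×-dec
          map′ (λ h {y} → h y) (λ h y → h {y}) (all? λ y → V? y →-dec (x ≟ y))

      LocatesAll : ∀ {t} → (Target V : Fin n → Set) → Algorithm t → Set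
      LocatesAll Target V A = ∀ x → Target x → Locates x V A

      -- One algorithm must serve all targets, so the search carries the set of targets for which
      -- the replies so far were legal. Relative to this set the continuations after the two replies
      -- can be found independently, and only finitely many queries remain to be tried.
      locatable? : ∀ t {Target V : Fin n → Set} → Decidable Target → Decidable V →
        Dec (Σ[ A ∈ Algorithm t ] LocatesAll Target V A)
      stoppable? : ∀ {Target V : Fin n → Set} → Decidable Target → Decidable V →
        Dec (∀ x → Target x → ∃[ x ] V x × (∀ {y} → V y → x ≡ y))
      stoppable? T? V? = all? λ x → T? x →-dec ∃!? V?

      locatable? zero T? V? = map′ (λ loc → stop , loc) (λ { (stop , loc) → loc }) (stoppable? T? V?)
      locatable? (suc t) {Target} {V} T? V? = map′ to from
        (stoppable? T? V? ⊎-dec any? λ u → any? λ v → query? u v ×-dec reply? u v ×-dec reply? v u)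
        where
        Reply : Fin n → Fin n → Set
        Reply u v = Σ[ A ∈ Algorithm t ]
          LocatesAll (λ x → Target x × Closer G u v x) (λ x → V x × Closer G u v x) A
        reply? : ∀ u v → Dec (Reply u v)
        reply? u v = locatable? t (λ x → T? x ×-dec closer? u v x) (λ x → V? x ×-dec closer? u v x)
        to : _ ⊎ (∃[ u ] ∃[ v ] Query u v × Reply u v × Reply v u) → _
        to (inj₁ loc) = stop , loc
        to (inj₂ (u , v , q , (A , locA) , (B , locB))) =
          ask u v q A B , λ x Tx → (λ cl → locA x (Tx , cl)) , (λ cl → locB x (Tx , cl))
        from : _ → _ ⊎ (∃[ u ] ∃[ v ] Query u v × Reply u v × Reply v u)
        from (stop , loc) = inj₁ loc
        from (ask u v q A B , loc) = inj₂ (u , v , q ,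
          (A , λ x (Tx , cl) → proj₁ (loc x Tx) cl) , (B , λ x (Tx , cl) → proj₂ (loc x Tx) cl))

      solvable? : Decidable Solvable
      solvable? t = map′ (λ (A , loc) → A , λ x → loc x tt) (λ (A , loc) → A , λ x _ → loc x)
        (locatable? t (λ _ → yes tt) (λ _ → yes tt))

      least-solvable : ∀ {s} → Solvable s → ∃[ t ] IsLeast t × t ℕ.≤ s
      least-solvable {s} solvable with t , solves , t≤s , min ← least solvable? s solvable =
        t , (solves , λ j solves-j → ℕ.≮⇒≥ λ j<t → min j j<t solves-j) , t≤s

      -- Ties are sent to `u`, so each target follows one legal sequence of replies and the list
      -- splits in two at each query. A target always remains a candidate; hence a leaf, with its
      -- unique candidate, receives at most one.
      locates⇒length≤2^t : ∀ {t} (A : Algorithm t) V xs → Unique xs →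
        All V xs → All (λ x → Locates x V A) xs → length xs ℕ.≤ 2 ^ t
      locates⇒length≤2^t stop V []  _ _ _ = z≤n
      locates⇒length≤2^t {t} stop V (_ ∷ []) _ _ _ = ℕ.m^n>0 2 t
      locates⇒length≤2^t stop V (x ∷ y ∷ _) ((x≢y ∷ _) ∷ _) (Vx ∷ Vy ∷ _) ((_ , _ , unique) ∷ _) =
        contradiction (trans (sym (unique Vx)) (unique Vy)) x≢y
      locates⇒length≤2^t {suc t} (ask u v q A B) V xs distinct Vs locs = begin
        length xs
          ≡⟨ length-filter-∁ u? xs ⟨
        length (filter u? xs) ℕ.+ length (filter (¬? ∘ u?) xs)
          ≤⟨ ℕ.+-mono-≤ left right ⟩
        2 ^ t ℕ.+ 2 ^ t
          ≡⟨ cong (2 ^ t ℕ.+_) (ℕ.+-identityʳ _) ⟨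
        2 ^ suc t ∎
        where
        open ℕ.≤-Reasoning
        u? : Decidable (Closer G u v)
        u? = closer? u v
        left = locates⇒length≤2^t A _ (filter u? xs) (Unique.filter⁺ u? distinct)
          (All.zipWith id (All.filter⁺ u? Vs , All.all-filter u? xs))
          (All.zipWith (λ (loc , cl) → proj₁ loc cl) (All.filter⁺ u? locs , All.all-filter u? xs))
        others : All (Closer G v u) (filter (¬? ∘ u?) xs)
        others = All.map (closer-total u v _) (All.all-filter (¬? ∘ u?) xs)
        right = locates⇒length≤2^t B _ (filter (¬? ∘ u?) xs) (Unique.filter⁺ (¬? ∘ u?) distinct)
          (All.zipWith id (All.filter⁺ (¬? ∘ u?) Vs , others))
          (All.zipWith (λ (loc , cl) → proj₂ loc cl) (All.filter⁺ (¬? ∘ u?) locs , others))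

      solvable⇒n≤2^t : ∀ {t} → Solvable t → n ℕ.≤ 2 ^ t
      solvable⇒n≤2^t {t} (A , loc) = subst (ℕ._≤ 2 ^ t) (length-tabulate {n = n} id)
        (locates⇒length≤2^t A _ (allFin n) (Unique.allFin⁺ n) (All.tabulate λ _ → tt) (All.tabulate λ _ → loc _))

  record QueryNumbers (m : ℕ) : Set where
    field
      pq eq : ℕ
      isPq  : IsPq G pq
      isEq  : IsEq G eq
      pq≤eq : pq ℕ.≤ eq
      eq≤m  : eq ℕ.≤ m
      n≤2^pq : n ℕ.≤ 2 ^ pq

  module _ (qs : List (Fin n × Fin n))
           (separated : ∀ x y → x ≢ y → Any (Separates x y) qs) where

    separates⇒walk : ∀ {x y} → Any (Separates x y) qs → Walk G 3 x y
    separates⇒walk any with _ , (u~v , (u~x , _) , (v~y , _)) ← satisfied any =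
      Adjacent-sym u~x ∷ u~v ∷ v~y ∷ []

    distance : ∀ x y → ∃[ k ] IsDist G x y k
    distance x y with x ≟ y
    ... | yes refl = 0 , [] , λ _ ()
    ... | no x≢y with k , w , _ , min ← least (λ k → walk? k x y) 3 (separates⇒walk (separated x y x≢y)) =
      k , w , min

    queryNumbers : QueryNumbers (length qs)
    queryNumbers
      with eq , isEq , eq≤ ← least-solvable distance (λ u v → Bool.T? (adj G u v))
             (nonadaptive-solves (edgesAmong qs)
                λ x y x≢y → separates⇒distinguishes qs (separated x y x≢y))
      -- An optimal edge strategy is also a pair strategy, which gives both the existence of `pq`
      -- and the comparison with `eq`.
      with pq , isPq , pq≤eq ← least-solvable distance (λ _ _ → yes tt) (edge⇒pair (proj₁ isEq))
      = record
      { isPq = isPq ; isEq = isEq ; pq≤eq = pq≤eq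
      ; eq≤m = ℕ.≤-trans eq≤ (length-edgesAmong qs)
      ; n≤2^pq = solvable⇒n≤2^t distance (λ _ _ → yes tt) (proj₁ isPq)
      }

-- Expectation over independent coins

0≤1ℚ : 0ℚ ≤ 1ℚ
0≤1ℚ = ℚ.nonNegative⁻¹ 1ℚ

complement-nonNeg : ∀ {x} → x ≤ 1ℚ → 0ℚ ≤ 1ℚ - x
complement-nonNeg {x} x≤1 = subst (_≤ 1ℚ - x) (ℚ.+-inverseʳ x) (ℚ.+-monoˡ-≤ (ℚ.- x) x≤1)

when : Bool → ℚ → ℚ
when b x = if b then x else 0ℚ

when-∧ : ∀ a b x → when (a ∧ b) x ≡ when a (when b x)
when-∧ true  b x = refl
when-∧ false b x = refl

when-nonNeg : ∀ b {x} → 0ℚ ≤ x → 0ℚ ≤ when b x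
when-nonNeg true  0≤x = 0≤x
when-nonNeg false _   = ℚ.≤-refl

when-not : ∀ b x → when b x + when (not b) x ≡ x
when-not true  x = ℚ.+-identityʳ x
when-not false x = ℚ.+-identityˡ x

pow : ℚ → ℕ → ℚ
pow x zero    = 1ℚ
pow x (suc k) = x * pow x k

sumOver : {A : Set} → (A → ℚ) → List A → ℚ
sumOver f xs = foldr _+_ 0ℚ (map f xs)

sumOver-++ : {A : Set} (f : A → ℚ) (xs ys : List A) →
  sumOver f (xs ++ ys) ≡ sumOver f xs + sumOver f ys
sumOver-++ f []       ys = sym (ℚ.+-identityˡ _)
sumOver-++ f (x ∷ xs) ys = trans (cong (f x +_) (sumOver-++ f xs ys)) (sym (ℚ.+-assoc (f x) _ _))

sumOver-map : {A B : Set} (f : B → ℚ) (g : A → B) (xs : List A) →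
  sumOver f (map g xs) ≡ sumOver (f ∘ g) xs
sumOver-map f g []       = refl
sumOver-map f g (x ∷ xs) = cong (f (g x) +_) (sumOver-map f g xs)

sumOver-cong : {A : Set} {f g : A → ℚ} → (∀ x → f x ≡ g x) → ∀ xs → sumOver f xs ≡ sumOver g xs
sumOver-cong f≗g []       = refl
sumOver-cong f≗g (x ∷ xs) = cong₂ _+_ (f≗g x) (sumOver-cong f≗g xs)

sumOver-*ˡ : {A : Set} (k : ℚ) (f : A → ℚ) (xs : List A) →
  sumOver (λ x → k * f x) xs ≡ k * sumOver f xs
sumOver-*ˡ k f []       = sym (ℚ.*-zeroʳ k)
sumOver-*ˡ k f (x ∷ xs) = trans (cong (k * f x +_) (sumOver-*ˡ k f xs)) (sym (ℚ.*-distribˡ-+ k _ _))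

sumOver-product : {A B C : Set} (h : A → B → C) (f : C → ℚ) (xs : List A) (ys : List B) →
  sumOver f (cartesianProductWith h xs ys) ≡ sumOver (λ x → sumOver (f ∘ h x) ys) xs
sumOver-product h f []       ys = refl
sumOver-product h f (x ∷ xs) ys = trans (sumOver-++ f (map (h x) ys) _)
  (cong₂ _+_ (sumOver-map f (h x) ys) (sumOver-product h f xs ys))

AgreeOff : ∀ {n} → Fin n → Fin n → Coins n → Coins n → Set
AgreeOff a b c c′ = ∀ k l → ¬ (k ≡ a × l ≡ b) → ¬ (k ≡ b × l ≡ a) → coinAt c k l ≡ coinAt c′ k l

Literal : ℕ → Set
Literal n = Fin n × Fin n × Bool

holds : ∀ {n} → Coins n → Literal n → Bool
holds c (a , b , s) = does (coinAt c a b Bool.≟ s)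

-- This is the form in which independence enters: `f` does not read the coin of the literal.
Unaffected : ∀ {n} → (Coins n → ℚ) → Literal n → Set
Unaffected f (a , b , _) = ∀ c c′ → AgreeOff a b c c′ → f c ≡ f c′

Disjoint : ∀ {n} → Literal n → Literal n → Set
Disjoint (a , b , _) (k , l , _) = ¬ (k ≡ a × l ≡ b) × ¬ (k ≡ b × l ≡ a)

module Expectation (p : ℚ) where

  weight : Bool → ℚ
  weight true  = p
  weight false = 1ℚ - p

  weight-sum : ∀ x → weight true * x + weight false * x ≡ x
  weight-sum x = solve 2 (λ p x → p :* x :+ (con 1ℚ :- p) :* x := x) refl p x
    where
    open ℚ-Solver

  -- Recursion over the coins allows a single one to be integrated out; `EV-sum` and `E-sum` recover
  -- the weighted sums over all outcomes.
  EV : ∀ {n} → (Vec Bool n → ℚ) → ℚ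
  EV {zero}  f = f []
  EV {suc n} f = weight true * EV (f ∘ (true ∷_)) + weight false * EV (f ∘ (false ∷_))

  E : ∀ {n} → (Coins n → ℚ) → ℚ
  E {zero}  f = f []
  E {suc n} f = EV λ r → E λ c → f (r ∷ c)

  EV-cong : ∀ {n} {f g : Vec Bool n → ℚ} → (∀ r → f r ≡ g r) → EV f ≡ EV g
  EV-cong {zero}  f≗g = f≗g []
  EV-cong {suc n} f≗g = cong₂ (λ x y → weight true * x + weight false * y)
    (EV-cong (f≗g ∘ (true ∷_))) (EV-cong (f≗g ∘ (false ∷_)))

  E-cong : ∀ {n} {f g : Coins n → ℚ} → (∀ c → f c ≡ g c) → E f ≡ E g
  E-cong {zero}  f≗g = f≗g []
  E-cong {suc n} f≗g = EV-cong λ r → E-cong λ c → f≗g (r ∷ c)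

  EV-const : ∀ {n} x → EV {n} (λ _ → x) ≡ x
  EV-const {zero}  x = refl
  EV-const {suc n} x = trans (cong (λ y → weight true * y + weight false * y) (EV-const {n} x))
    (weight-sum x)

  E-const : ∀ {n} x → E {n} (λ _ → x) ≡ x
  E-const {zero}  x = refl
  E-const {suc n} x = trans (EV-cong {n} λ _ → E-const {n} x) (EV-const {n} x)

  EV-+ : ∀ {n} (f g : Vec Bool n → ℚ) → EV (λ r → f r + g r) ≡ EV f + EV g
  EV-+ {zero}  f g = refl
  EV-+ {suc n} f g = trans
    (cong₂ (λ x y → weight true * x + weight false * y)
      (EV-+ (f ∘ (true ∷_)) (g ∘ (true ∷_))) (EV-+ (f ∘ (false ∷_)) (g ∘ (false ∷_))))
    (solve 6 (λ p q a b c d → p :* (a :+ b) :+ q :* (c :+ d) := (p :* a :+ q :* c) :+ (p :* b :+ q :* d))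
      refl (weight true) (weight false) (EV (f ∘ (true ∷_))) (EV (g ∘ (true ∷_)))
      (EV (f ∘ (false ∷_))) (EV (g ∘ (false ∷_))))
    where
    open ℚ-Solver

  E-+ : ∀ {n} (f g : Coins n → ℚ) → E (λ c → f c + g c) ≡ E f + E g
  E-+ {zero}  f g = refl
  E-+ {suc n} f g = trans (EV-cong λ r → E-+ (f ∘ (r ∷_)) (g ∘ (r ∷_))) (EV-+ {n} _ _)

  E-when : ∀ {n} b (f : Coins n → ℚ) → E (λ c → when b (f c)) ≡ when b (E f)
  E-when     true  f = refl
  E-when {n} false f = E-const {n} 0ℚ

  -- Both values of coin `j` leave the same expectation of `g`, and the indicator keeps just one of
  -- the two weights.
  EV-when-lookup : ∀ {n} j s (g : Vec Bool n → ℚ) →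
    (∀ r r′ → (∀ i → i ≢ j → lookup r i ≡ lookup r′ i) → g r ≡ g r′) →
    EV (λ r → when (does (lookup r j Bool.≟ s)) (g r)) ≡ weight s * EV g
  EV-when-lookup {suc n} zero s g inv = begin
    weight true * EV (λ r → when (does (true Bool.≟ s)) (g (true ∷ r))) +
    weight false * EV (λ r → when (does (false Bool.≟ s)) (g (false ∷ r)))
      ≡⟨ first-coin s ⟩
    weight s * (weight true * EV (g ∘ (true ∷_)) + weight false * EV (g ∘ (true ∷_)))
      ≡⟨ cong (λ x → weight s * (weight true * EV (g ∘ (true ∷_)) + weight false * x)) same ⟩
    weight s * EV g ∎
    where
    open ≡-Reasoning
    open ℚ-Solver
    same : EV (g ∘ (true ∷_)) ≡ EV (g ∘ (false ∷_))
    same = EV-cong λ r → inv (true ∷ r) (false ∷ r)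
      λ { zero i≢j → contradiction refl i≢j ; (suc _) _ → refl }
    first-coin : ∀ s →
      weight true * EV (λ r → when (does (true Bool.≟ s)) (g (true ∷ r))) +
      weight false * EV (λ r → when (does (false Bool.≟ s)) (g (false ∷ r)))
      ≡ weight s * (weight true * EV (g ∘ (true ∷_)) + weight false * EV (g ∘ (true ∷_)))
    first-coin true  = trans
      (cong (λ y → weight true * EV (g ∘ (true ∷_)) + weight false * y) (EV-const {n} 0ℚ))
      (solve 2 (λ p x → p :* x :+ (con 1ℚ :- p) :* con 0ℚ :=
                        p :* (p :* x :+ (con 1ℚ :- p) :* x)) refl p (EV (g ∘ (true ∷_))))
    first-coin false = trans
      (cong₂ (λ x y → weight true * x + weight false * y) (EV-const {n} 0ℚ) (sym same))
      (solve 2 (λ p x → p :* con 0ℚ :+ (con 1ℚ :- p) :* x :=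
                        (con 1ℚ :- p) :* (p :* x :+ (con 1ℚ :- p) :* x)) refl p (EV (g ∘ (true ∷_))))
  EV-when-lookup {suc n} (suc j) s g inv = trans
    (cong₂ (λ x y → weight true * x + weight false * y) (rest true) (rest false))
    (solve 5 (λ p q s a b → p :* (s :* a) :+ q :* (s :* b) := s :* (p :* a :+ q :* b)) refl
      (weight true) (weight false) (weight s) (EV (g ∘ (true ∷_))) (EV (g ∘ (false ∷_))))
    where
    open ℚ-Solver
    rest : ∀ b → _ ≡ weight s * EV (g ∘ (b ∷_))
    rest b = EV-when-lookup j s (g ∘ (b ∷_)) λ r r′ agree → inv (b ∷ r) (b ∷ r′)
      λ { zero _ → refl ; (suc i) i≢j → agree i (i≢j ∘ cong suc) }

  EV-*ˡ : ∀ {n} k (f : Vec Bool n → ℚ) → EV (λ r → k * f r) ≡ k * EV f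
  EV-*ˡ {zero}  k f = refl
  EV-*ˡ {suc n} k f = trans
    (cong₂ (λ x y → weight true * x + weight false * y) (EV-*ˡ k (f ∘ (true ∷_))) (EV-*ˡ k (f ∘ (false ∷_))))
    (solve 5 (λ p q s a b → p :* (s :* a) :+ q :* (s :* b) := s :* (p :* a :+ q :* b)) refl
      (weight true) (weight false) k (EV (f ∘ (true ∷_))) (EV (f ∘ (false ∷_))))
    where
    open ℚ-Solver

  E-when-holds : ∀ {n} (l : Literal n) (g : Coins n → ℚ) → proj₁ l ≢ proj₁ (proj₂ l) →
    Unaffected g l → E (λ c → when (holds c l) (g c)) ≡ weight (proj₂ (proj₂ l)) * E g
  E-when-holds (zero , zero , s) g a≢b inv = contradiction refl a≢b
  E-when-holds (zero , suc b , s) g a≢b inv = trans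
    (EV-cong λ r → E-when (does (lookup r b Bool.≟ s)) (g ∘ (r ∷_)))
    (EV-when-lookup b s (λ r → E λ c → g (r ∷ c)) λ r r′ agree → E-cong λ c →
      inv (r ∷ c) (r′ ∷ c) λ
        { zero    zero    _ _ → refl
        ; zero    (suc l) h _ → agree l (λ { refl → h (refl , refl) })
        ; (suc k) zero    _ h → agree k (λ { refl → h (refl , refl) })
        ; (suc k) (suc l) _ _ → refl })
  -- The coin of an unordered pair is stored once, so this is the previous case with the endpoints
  -- exchanged.
  E-when-holds (suc a , zero , s) g a≢b inv =
    E-when-holds (zero , suc a , s) g (λ ()) λ c c′ agree → inv c c′ λ k l h h′ → agree k l h′ h
  E-when-holds (suc a , suc b , s) g a≢b inv = trans
    (EV-cong λ r → E-when-holds (a , b , s) (g ∘ (r ∷_)) (a≢b ∘ cong suc) λ c c′ agree →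
      inv (r ∷ c) (r ∷ c′) λ
        { zero    zero    _ _  → refl
        ; zero    (suc l) _ _  → refl
        ; (suc k) zero    _ _  → refl
        ; (suc k) (suc l) h h′ → agree k l (λ { (refl , refl) → h (refl , refl) })
                                           (λ { (refl , refl) → h′ (refl , refl) }) })
    (EV-*ˡ (weight s) λ r → E λ c → g (r ∷ c))

  weights : ∀ {n} → List (Literal n) → ℚ
  weights []                = 1ℚ
  weights ((_ , _ , s) ∷ ls) = weight s * weights ls

  -- The literals are peeled off one by one: by disjointness the remaining ones do not read the coin
  -- of the first.
  E-when-all-hold : ∀ {n} (ls : List (Literal n)) (g : Coins n → ℚ) →
    AllPairs Disjoint ls → All (λ (a , b , _) → a ≢ b) ls → All (Unaffected g) ls →
    E (λ c → when (all (holds c) ls) (g c)) ≡ weights ls * E g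
  E-when-all-hold [] g _ _ _ = sym (ℚ.*-identityˡ _)
  E-when-all-hold (l@(a , b , s) ∷ ls) g (d ∷ ds) (a≢b ∷ loopless) (inv ∷ invs) = begin
    E (λ c → when (holds c l ∧ all (holds c) ls) (g c))
      ≡⟨ E-cong (λ c → when-∧ (holds c l) (all (holds c) ls) (g c)) ⟩
    E (λ c → when (holds c l) (when (all (holds c) ls) (g c)))
      ≡⟨ E-when-holds l _ a≢b (λ c c′ agree → cong₂ when (same c c′ agree d) (inv c c′ agree)) ⟩
    weight s * E (λ c → when (all (holds c) ls) (g c))
      ≡⟨ cong (weight s *_) (E-when-all-hold ls g ds loopless invs) ⟩
    weight s * (weights ls * E g)
      ≡⟨ ℚ.*-assoc (weight s) (weights ls) (E g) ⟨
    weights (l ∷ ls) * E g ∎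
    where
    open ≡-Reasoning
    same : ∀ c c′ → AgreeOff a b c c′ → ∀ {ls} → All (Disjoint l) ls →
      all (holds c) ls ≡ all (holds c′) ls
    same c c′ agree []                        = refl
    same c c′ agree {(k , m , t) ∷ _} ((h , h′) ∷ ds) =
      cong₂ _∧_ (cong (λ x → does (x Bool.≟ t)) (agree k m h h′)) (same c c′ agree ds)

  massVecℚ : ∀ {n} → Vec Bool n → ℚ
  massVecℚ []      = 1ℚ
  massVecℚ (b ∷ r) = weight b * massVecℚ r

  massℚ : ∀ {n} → Coins n → ℚ
  massℚ []      = 1ℚ
  massℚ (r ∷ c) = massVecℚ r * massℚ c

  EV-sum : ∀ {n} (f : Vec Bool n → ℚ) → sumOver (λ r → massVecℚ r * f r) (allVecs n) ≡ EV f
  EV-sum {zero}  f = trans (ℚ.+-identityʳ _) (ℚ.*-identityˡ (f []))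
  EV-sum {suc n} f = begin
    sumOver F (allVecs (suc n))
      ≡⟨ sumOver-product {A = Bool} _∷_ F (true ∷ false ∷ []) (allVecs n) ⟩
    sumOver (F ∘ (true ∷_)) (allVecs n) + (sumOver (F ∘ (false ∷_)) (allVecs n) + 0ℚ)
      ≡⟨ cong₂ _+_ (half true) (trans (ℚ.+-identityʳ _) (half false)) ⟩
    EV f ∎
    where
    open ≡-Reasoning
    F : Vec Bool (suc n) → ℚ
    F r = massVecℚ r * f r
    half : ∀ b → sumOver (F ∘ (b ∷_)) (allVecs n) ≡ weight b * EV (f ∘ (b ∷_))
    half b = trans
      (sumOver-cong (λ r → ℚ.*-assoc (weight b) (massVecℚ r) (f (b ∷ r))) (allVecs n))
      (trans (sumOver-*ˡ (weight b) _ (allVecs n)) (cong (weight b *_) (EV-sum (f ∘ (b ∷_)))))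

  E-sum : ∀ {n} (f : Coins n → ℚ) → sumOver (λ c → massℚ c * f c) (allCoins n) ≡ E f
  E-sum {zero}  f = trans (ℚ.+-identityʳ _) (ℚ.*-identityˡ (f []))
  E-sum {suc n} f = begin
    sumOver (λ c → massℚ c * f c) (allCoins (suc n))
      ≡⟨ sumOver-product _∷_ (λ c → massℚ c * f c) (allVecs n) (allCoins n) ⟩
    sumOver (λ r → sumOver (λ c → massVecℚ r * massℚ c * f (r ∷ c)) (allCoins n)) (allVecs n)
      ≡⟨ sumOver-cong row (allVecs n) ⟩
    sumOver (λ r → massVecℚ r * E (f ∘ (r ∷_))) (allVecs n)
      ≡⟨ EV-sum (λ r → E (f ∘ (r ∷_))) ⟩
    E f ∎
    where
    open ≡-Reasoning
    row : ∀ r → sumOver (λ c → massVecℚ r * massℚ c * f (r ∷ c)) (allCoins n) ≡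
      massVecℚ r * E (f ∘ (r ∷_))
    row r = trans
      (sumOver-cong (λ c → ℚ.*-assoc (massVecℚ r) (massℚ c) (f (r ∷ c))) (allCoins n))
      (trans (sumOver-*ˡ (massVecℚ r) _ (allCoins n)) (cong (massVecℚ r *_) (E-sum (f ∘ (r ∷_)))))

  Prob : ∀ {n} → (Coins n → Bool) → ℚ
  Prob S = E λ c → when (S c) 1ℚ

  Prob-not : ∀ {n} (S : Coins n → Bool) → Prob S + Prob (not ∘ S) ≡ 1ℚ
  Prob-not {n} S = trans (sym (E-+ {n} _ _))
    (trans (E-cong λ c → when-not (S c) 1ℚ) (E-const {n} 1ℚ))

  module _ (0≤p : 0ℚ ≤ p) (p≤1 : p ≤ 1ℚ) where

    weight-nonNeg : ∀ b → NonNegative (weight b)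
    weight-nonNeg true  = nonNegative 0≤p
    weight-nonNeg false = nonNegative (complement-nonNeg p≤1)

    EV-mono : ∀ {n} {f g : Vec Bool n → ℚ} → (∀ r → f r ≤ g r) → EV f ≤ EV g
    EV-mono {zero}  f≤g = f≤g []
    EV-mono {suc n} f≤g = ℚ.+-mono-≤
      (ℚ.*-monoˡ-≤-nonNeg (weight true) {{weight-nonNeg true}} (EV-mono (f≤g ∘ (true ∷_))))
      (ℚ.*-monoˡ-≤-nonNeg (weight false) {{weight-nonNeg false}} (EV-mono (f≤g ∘ (false ∷_))))

    E-mono : ∀ {n} {f g : Coins n → ℚ} → (∀ c → f c ≤ g c) → E f ≤ E g
    E-mono {zero}  f≤g = f≤g []
    E-mono {suc n} f≤g = EV-mono λ r → E-mono λ c → f≤g (r ∷ c)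

    when-mono : ∀ {a b} → (T a → T b) → when a 1ℚ ≤ when b 1ℚ
    when-mono {true}  {true}  _ = ℚ.≤-refl
    when-mono {true}  {false} h = contradiction _ h
    when-mono {false} {b}     _ = when-nonNeg b 0≤1ℚ

    Prob-≤1 : ∀ {n} (S : Coins n → Bool) → Prob S ≤ 1ℚ
    Prob-≤1 {n} S = ℚ.≤-trans (E-mono λ c → when-mono {S c} {true} _) (ℚ.≤-reflexive (E-const {n} 1ℚ))

    union-bound : ∀ {n} {A : Set} (S : A → Coins n → Bool) (β : ℚ) →
      (∀ a → Prob (not ∘ S a) ≤ β) →
      ∀ xs → Prob (λ c → not (all (λ a → S a c) xs)) ≤ fromℕℚ (length xs) * β
    union-bound {n} S β bound [] = ℚ.≤-reflexive (trans (E-const {n} 0ℚ) (sym (ℚ.*-zeroˡ β)))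
    union-bound {n} S β bound (x ∷ xs) = begin
      Prob (λ c → not (S x c ∧ all (λ a → S a c) xs))
        ≤⟨ E-mono (λ c → either (S x c) (all (λ a → S a c) xs)) ⟩
      E (λ c → when (not (S x c)) 1ℚ + when (not (all (λ a → S a c) xs)) 1ℚ)
        ≡⟨ E-+ {n} _ _ ⟩
      Prob (not ∘ S x) + Prob (λ c → not (all (λ a → S a c) xs))
        ≤⟨ ℚ.+-mono-≤ (bound x) (union-bound S β bound xs) ⟩
      β + fromℕℚ (length xs) * β
        ≡⟨ solve 2 (λ k β → β :+ k :* β := (k :+ con 1ℚ) :* β) refl (fromℕℚ (length xs)) β ⟩
      (fromℕℚ (length xs) + 1ℚ) * β
        ≡⟨ cong (_* β) (fromℕℚ-suc (length xs)) ⟨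
      fromℕℚ (suc (length xs)) * β ∎
      where
      open ℚ.≤-Reasoning
      open ℚ-Solver
      either : ∀ a b → when (not (a ∧ b)) 1ℚ ≤ when (not a) 1ℚ + when (not b) 1ℚ
      either true  b     = ℚ.≤-reflexive (sym (ℚ.+-identityˡ _))
      either false true  = ℚ.≤-reflexive (sym (ℚ.+-identityʳ _))
      either false false = ℚ.≤ᵇ⇒≤ _

-- Separation by disjoint pairs

length-cartesianProduct : {A B : Set} (xs : List A) (ys : List B) →
  length (cartesianProduct xs ys) ≡ length xs ℕ.* length ys
length-cartesianProduct []       ys = refl
length-cartesianProduct (x ∷ xs) ys = trans (length-++ (map (x ,_) ys))
  (cong₂ ℕ._+_ (length-map (x ,_) ys) (length-cartesianProduct xs ys))

-- Three classes, so that any two vertices x and y are avoided by all the pairs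
-- of some class; the separations of x and y by those pairs are independent.
record Pairs (n m : ℕ) : Set where
  field
    u v     : Fin 3 → ℕ → Fin n
    class   : Fin n → ℕ
    index   : Fin n → ℕ
    class-u : ∀ ρ {j} → j ℕ.< m → class (u ρ j) ≡ toℕ ρ
    class-v : ∀ ρ {j} → j ℕ.< m → class (v ρ j) ≡ toℕ ρ
    index-u : ∀ ρ {j} → j ℕ.< m → index (u ρ j) ≡ j
    index-v : ∀ ρ {j} → j ℕ.< m → index (v ρ j) ≡ j
    u≢v     : ∀ ρ {j} → j ℕ.< m → u ρ j ≢ v ρ j

  pairs : Fin 3 → ℕ → List (Fin n × Fin n)
  pairs ρ zero    = []
  pairs ρ (suc j) = (u ρ j , v ρ j) ∷ pairs ρ j

  length-pairs : ∀ ρ j → length (pairs ρ j) ≡ j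
  length-pairs ρ zero    = refl
  length-pairs ρ (suc j) = cong suc (length-pairs ρ j)

avoid : ∀ (a b : ℕ) → Σ[ ρ ∈ Fin 3 ] a ≢ toℕ ρ × b ≢ toℕ ρ
avoid 0             0             = suc zero , (λ ()) , (λ ())
avoid 0             1             = suc (suc zero) , (λ ()) , (λ ())
avoid 0             (suc (suc _)) = suc zero , (λ ()) , (λ ())
avoid 1             0             = suc (suc zero) , (λ ()) , (λ ())
avoid (suc (suc _)) 0             = suc zero , (λ ()) , (λ ())
avoid (suc _)       (suc _)       = zero , (λ ()) , (λ ())

-- The assumption makes the reduction modulo suc n in vertex harmless.
standardPairs : ∀ n m → m ℕ.* 6 ℕ.≤ suc n → Pairs (suc n) m
standardPairs n m 6m≤n = record
  -- The j-th block of six consecutive vertices gives class ρ the pair 6j + ρ, 6j + ρ + 3. The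
  -- quotient by 6 recovers j, and the remainder, reduced modulo 3, recovers ρ.
  { u = λ ρ j → vertex (toℕ ρ) j
  ; v = λ ρ j → vertex (toℕ ρ ℕ.+ 3) j
  ; class = λ x → toℕ x % 6 % 3
  ; index = λ x → toℕ x / 6
  ; class-u = λ ρ j<m → trans (cong (_% 3) (rem (low ρ) j<m)) (low%3 ρ)
  ; class-v = λ ρ j<m → trans (cong (_% 3) (rem (high ρ) j<m)) (high%3 ρ)
  ; index-u = λ ρ → quot (low ρ)
  ; index-v = λ ρ → quot (high ρ)
  ; u≢v = λ ρ j<m u≡v → ℕ.m≢1+m+n (toℕ ρ) (trans
      (trans (sym (rem (low ρ) j<m)) (trans (cong (λ x → toℕ x % 6) u≡v) (rem (high ρ) j<m)))
      (ℕ.+-suc (toℕ ρ) 2))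
  }
  where
  vertex : ℕ → ℕ → Fin (suc n)
  vertex r j = (r ℕ.+ j ℕ.* 6) mod suc n

  low : (ρ : Fin 3) → toℕ ρ ℕ.< 6
  low zero             = ℕ.≤ᵇ⇒≤ _ _ _
  low (suc zero)       = ℕ.≤ᵇ⇒≤ _ _ _
  low (suc (suc zero)) = ℕ.≤ᵇ⇒≤ _ _ _

  high : (ρ : Fin 3) → toℕ ρ ℕ.+ 3 ℕ.< 6
  high zero             = ℕ.≤ᵇ⇒≤ _ _ _
  high (suc zero)       = ℕ.≤ᵇ⇒≤ _ _ _
  high (suc (suc zero)) = ℕ.≤ᵇ⇒≤ _ _ _

  low%3 : (ρ : Fin 3) → toℕ ρ % 3 ≡ toℕ ρ
  low%3 zero             = refl
  low%3 (suc zero)       = refl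
  low%3 (suc (suc zero)) = refl

  high%3 : (ρ : Fin 3) → (toℕ ρ ℕ.+ 3) % 3 ≡ toℕ ρ
  high%3 zero             = refl
  high%3 (suc zero)       = refl
  high%3 (suc (suc zero)) = refl

  toℕ-vertex : ∀ {r j} → r ℕ.< 6 → j ℕ.< m → toℕ (vertex r j) ≡ r ℕ.+ j ℕ.* 6
  toℕ-vertex {r} {j} r<6 j<m = trans (toℕ-fromℕ< _) (m<n⇒m%n≡m
    (ℕ.<-≤-trans (ℕ.+-monoˡ-< (j ℕ.* 6) r<6) (ℕ.≤-trans (ℕ.*-monoˡ-≤ 6 j<m) 6m≤n)))

  rem : ∀ {r j} → r ℕ.< 6 → j ℕ.< m → toℕ (vertex r j) % 6 ≡ r
  rem {r} {j} r<6 j<m = trans (cong (_% 6) (toℕ-vertex r<6 j<m))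
    (trans ([m+kn]%n≡m%n r j 6) (m<n⇒m%n≡m r<6))

  quot : ∀ {r j} → r ℕ.< 6 → j ℕ.< m → toℕ (vertex r j) / 6 ≡ j
  quot {r} {j} r<6 j<m = trans (cong (_/ 6) (toℕ-vertex r<6 j<m))
    (trans (+-distrib-/-∣ʳ r (n∣m*n j)) (cong₂ ℕ._+_ (m<n⇒m/n≡0 r<6) (m*n/n≡m j 6)))

-- These are the conditions of `Separates` that depend on coins; its two inequalities come from the
-- choice of the class.
separation : ∀ {n} → Fin n → Fin n → Fin n × Fin n → List (Literal n)
separation x y (u , v) =
  (u , v , true) ∷ (u , x , true) ∷ (v , x , false) ∷ (v , y , true) ∷ (u , y , false) ∷ []

separates : ∀ {n} → Coins n → Fin n → Fin n → Fin n × Fin n → Bool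
separates c x y e = all (holds c) (separation x y e)

separates⇒Separates : ∀ {n} (c : Coins n) {x y u v} → v ≢ x → u ≢ y →
  T (separates c x y (u , v)) → Separates (graph c) x y (u , v)
separates⇒Separates c {x} {y} {u} {v} v≢x u≢y sep
  with uv ∷ ux ∷ vx ∷ vy ∷ uy ∷ [] ← All.all⁺ (holds c) (separation x y (u , v)) sep =
  present uv , (present ux , v≢x , absent vx) , (present vy , u≢y , absent uy)
  where
  present : ∀ {b} → T (does (b Bool.≟ true)) → T b
  present {true} _ = _
  absent : ∀ {b} → T (does (b Bool.≟ false)) → ¬ T b
  absent {true}  bad _ = bad

-- Each of the five coins joins two of `x`, `y`, `u`, `v`, so a coin with an endpoint `a` outside
-- these four is not read.
separates-cong : ∀ {n} {a b : Fin n} c c′ → AgreeOff a b c c′ → ∀ {x y u v} →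
  x ≢ a → y ≢ a → u ≢ a → v ≢ a → separates c x y (u , v) ≡ separates c′ x y (u , v)
separates-cong c c′ agree x≢a y≢a u≢a v≢a =
  cong₂ _∧_ (same true u≢a v≢a) (cong₂ _∧_ (same true u≢a x≢a) (cong₂ _∧_ (same false v≢a x≢a)
    (cong₂ _∧_ (same true v≢a y≢a) (cong₂ _∧_ (same false u≢a y≢a) refl))))
  where
  same : ∀ s {k l} → k ≢ _ → l ≢ _ → _
  same s k≢a l≢a = cong (λ z → does (z Bool.≟ s))
    (agree _ _ (λ (k≡a , _) → k≢a k≡a) (λ (_ , l≡a) → l≢a l≡a))

-- weights (separation x y e), the probability that e separates x and y.
p³q² : ℚ → ℚ → ℚ
p³q² p q = p * (p * (q * (p * (q * 1ℚ))))

module Separation {n m : ℕ} (P : Pairs n m) where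
  open Pairs P

  colour : Fin n → Fin n → Fin 3
  colour x y = proj₁ (avoid (class x) (class y))

  x≢pairs : ∀ {x ρ j} → class x ≢ toℕ ρ → j ℕ.< m → x ≢ u ρ j × x ≢ v ρ j
  x≢pairs {ρ = ρ} x≢ρ j<m =
    (λ { refl → x≢ρ (class-u ρ j<m) }) , (λ { refl → x≢ρ (class-v ρ j<m) })

  -- Testing only one class that avoids `x` and `y` makes the failure probability an exact power.
  -- The diagonal counts as resolved, so that the union bound can run over the full product.
  resolved : Fin n × Fin n → Coins n → Bool
  resolved (x , y) c = does (x ≟ y) ∨ any (separates c x y) (pairs (colour x y) m)

  allResolved : Coins n → Bool
  allResolved c = all (λ xy → resolved xy c) (cartesianProduct (allFin n) (allFin n))

  -- The suitable class varies with `x` and `y`, so all three are queried.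
  queries : List (Fin n × Fin n)
  queries = pairs zero m ++ pairs (suc zero) m ++ pairs (suc (suc zero)) m

  length-queries : length queries ≡ 3 ℕ.* m
  length-queries = trans (length-++ (pairs zero m)) (cong₂ ℕ._+_ (length-pairs zero m)
    (trans (length-++ (pairs (suc zero) m)) (cong₂ ℕ._+_ (length-pairs (suc zero) m)
      (trans (length-pairs (suc (suc zero)) m) (sym (ℕ.+-identityʳ m))))))

  pairs⇒queries : ∀ {Q : Fin n × Fin n → Set} ρ → Any Q (pairs ρ m) → Any Q queries
  pairs⇒queries zero             = Any.++⁺ˡ
  pairs⇒queries (suc zero)       = Any.++⁺ʳ (pairs zero m) ∘ Any.++⁺ˡ
  pairs⇒queries (suc (suc zero)) = Any.++⁺ʳ (pairs zero m) ∘ Any.++⁺ʳ (pairs (suc zero) m)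

  separated-by-pairs : ∀ c {x y} ρ → class x ≢ toℕ ρ → class y ≢ toℕ ρ → ∀ j → j ℕ.≤ m →
    Any (T ∘ separates c x y) (pairs ρ j) → Any (Separates (graph c) x y) (pairs ρ j)
  separated-by-pairs c ρ x≢ρ y≢ρ (suc j) j<m (here sep) = here (separates⇒Separates c
    (≢-sym (proj₂ (x≢pairs x≢ρ j<m))) (≢-sym (proj₁ (x≢pairs y≢ρ j<m))) sep)
  separated-by-pairs c ρ x≢ρ y≢ρ (suc j) j<m (there later) =
    there (separated-by-pairs c ρ x≢ρ y≢ρ j (ℕ.<⇒≤ j<m) later)

  allResolved⇒separated : ∀ c → T (allResolved c) →
    ∀ x y → x ≢ y → Any (Separates (graph c) x y) queries
  allResolved⇒separated c all-resolved x y x≢y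
    with x ≟ y
       | All.lookup (All.all⁺ (λ xy → resolved xy c) _ all-resolved)
           (∈-cartesianProduct⁺ (∈-allFin x) (∈-allFin y))
  ... | yes x≡y | _   = contradiction x≡y x≢y
  ... | no _    | res =
    let x≢ρ , y≢ρ = proj₂ (avoid (class x) (class y)) in
    pairs⇒queries (colour x y) (separated-by-pairs c (colour x y) x≢ρ y≢ρ m ℕ.≤-refl
      (Any.any⁻ (separates c x y) _ res))

  module Bound (p : ℚ) where
    open Expectation p

    δ : ℚ
    δ = p³q² p (1ℚ - p)

    unseparated : Fin n → Fin n → Fin 3 → ℕ → Coins n → Bool
    unseparated x y ρ j c = not (any (separates c x y) (pairs ρ j))

    module _ {x y : Fin n} {ρ : Fin 3} (x≢y : x ≢ y)
             (x≢ρ : class x ≢ toℕ ρ) (y≢ρ : class y ≢ toℕ ρ) where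

      -- Here `a` stands for an endpoint of the j-th pair: its index tells it apart from the
      -- endpoints of earlier pairs, and its class from `x` and `y`.
      unaffected : ∀ {a b} c c′ k j → k ℕ.≤ j → j ℕ.< m → index a ≡ j → class a ≡ toℕ ρ →
        AgreeOff a b c c′ → unseparated x y ρ k c ≡ unseparated x y ρ k c′
      unaffected c c′ k j k≤j j<m index-a class-a agree = cong not (go k k≤j)
        where
        go : ∀ k → k ℕ.≤ j → any (separates c x y) (pairs ρ k) ≡ any (separates c′ x y) (pairs ρ k)
        go zero    _   = refl
        go (suc k) k<j = cong₂ _∨_
          (separates-cong c c′ agree
            (λ { refl → x≢ρ class-a }) (λ { refl → y≢ρ class-a })
            (λ { refl → ℕ.<⇒≢ k<j (trans (sym (index-u ρ (ℕ.<-trans k<j j<m))) index-a) })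
            (λ { refl → ℕ.<⇒≢ k<j (trans (sym (index-v ρ (ℕ.<-trans k<j j<m))) index-a) }))
          (go k (ℕ.<⇒≤ k<j))

      Prob-separates-next : ∀ j → j ℕ.< m →
        E (λ c → when (separates c x y (u ρ j , v ρ j)) (when (unseparated x y ρ j c) 1ℚ)) ≡
        δ * Prob (unseparated x y ρ j)
      Prob-separates-next j j<m = E-when-all-hold (separation x y (u ρ j , v ρ j)) _
        -- The 4 + 3 + 2 + 1 entries check that the five coins are pairwise different. Each coin is
        -- listed with its first endpoint in the j-th pair, as `unaffected` requires.
        ( ( ((λ (_ , x≡v) → proj₂ x≢ x≡v) , (λ (u≡v , _) → uv u≡v))
          ∷ ((λ (v≡u , _) → uv (sym v≡u)) , (λ (_ , x≡u) → proj₁ x≢ x≡u))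
          ∷ ((λ (v≡u , _) → uv (sym v≡u)) , (λ (_ , y≡u) → proj₁ y≢ y≡u))
          ∷ ((λ (_ , y≡v) → proj₂ y≢ y≡v) , (λ (u≡v , _) → uv u≡v))
          ∷ [])
        ∷ ( ((λ (v≡u , _) → uv (sym v≡u)) , (λ (_ , x≡u) → proj₁ x≢ x≡u))
          ∷ ((λ (v≡u , _) → uv (sym v≡u)) , (λ (_ , y≡u) → proj₁ y≢ y≡u))
          ∷ ((λ (_ , y≡x) → x≢y (sym y≡x)) , (λ (u≡x , _) → proj₁ x≢ (sym u≡x)))
          ∷ [])
        ∷ ( ((λ (_ , y≡x) → x≢y (sym y≡x)) , (λ (v≡x , _) → proj₂ x≢ (sym v≡x)))
          ∷ ((λ (u≡v , _) → uv u≡v) , (λ (_ , y≡v) → proj₂ y≢ y≡v))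
          ∷ [])
        ∷ ( ((λ (u≡v , _) → uv u≡v) , (λ (_ , y≡v) → proj₂ y≢ y≡v))
          ∷ [])
        ∷ [] ∷ [])
        (uv ∷ ≢-sym (proj₁ x≢) ∷ ≢-sym (proj₂ x≢) ∷ ≢-sym (proj₂ y≢) ∷ ≢-sym (proj₁ y≢) ∷ [])
        (at-u ∷ at-u ∷ at-v ∷ at-v ∷ at-u ∷ [])
        where
        uv = u≢v ρ j<m
        x≢ = x≢pairs {x} x≢ρ j<m
        y≢ = x≢pairs {y} y≢ρ j<m
        at-u : ∀ {b} c c′ → AgreeOff (u ρ j) b c c′ →
          when (unseparated x y ρ j c) 1ℚ ≡ when (unseparated x y ρ j c′) 1ℚ
        at-u c c′ agree = cong (λ z → when z 1ℚ)
          (unaffected c c′ j j ℕ.≤-refl j<m (index-u ρ j<m) (class-u ρ j<m) agree)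
        at-v : ∀ {b} c c′ → AgreeOff (v ρ j) b c c′ →
          when (unseparated x y ρ j c) 1ℚ ≡ when (unseparated x y ρ j c′) 1ℚ
        at-v c c′ agree = cong (λ z → when z 1ℚ)
          (unaffected c c′ j j ℕ.≤-refl j<m (index-v ρ j<m) (class-v ρ j<m) agree)

      -- Failure of `suc j` pairs is failure of the first `j`, minus the part where the next pair
      -- separates; by independence that part is the fraction `δ`.
      Prob-unseparated : ∀ j → j ℕ.≤ m → Prob (unseparated x y ρ j) ≡ pow (1ℚ - δ) j
      Prob-unseparated zero    _   = E-const {n} 1ℚ
      Prob-unseparated (suc j) j<m = begin
        Prob (unseparated x y ρ (suc j))
          ≡⟨ solve 2 (λ a b → a := (a :+ b) :- b) refl (Prob (unseparated x y ρ (suc j))) next ⟩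
        Prob (unseparated x y ρ (suc j)) + next - next
          ≡⟨ cong (_- next) (E-+ {n} _ _) ⟨
        E (λ c → when (unseparated x y ρ (suc j) c) 1ℚ + when (sep c) (when (unseparated x y ρ j c) 1ℚ)) - next
          ≡⟨ cong₂ _-_ (E-cong λ c → split (sep c) (any (separates c x y) (pairs ρ j)))
                       (Prob-separates-next j j<m) ⟩
        Prob (unseparated x y ρ j) - δ * Prob (unseparated x y ρ j)
          ≡⟨ solve 2 (λ a d → a :- d :* a := (con 1ℚ :- d) :* a) refl (Prob (unseparated x y ρ j)) δ ⟩
        (1ℚ - δ) * Prob (unseparated x y ρ j)
          ≡⟨ cong ((1ℚ - δ) *_) (Prob-unseparated j (ℕ.<⇒≤ j<m)) ⟩
        pow (1ℚ - δ) (suc j) ∎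
        where
        open ≡-Reasoning
        open ℚ-Solver
        sep : Coins n → Bool
        sep c = separates c x y (u ρ j , v ρ j)
        next : ℚ
        next = E λ c → when (sep c) (when (unseparated x y ρ j c) 1ℚ)
        split : ∀ a b → when (not (a ∨ b)) 1ℚ + when a (when (not b) 1ℚ) ≡ when (not b) 1ℚ
        split true  b = ℚ.+-identityˡ _
        split false b = ℚ.+-identityʳ _

    module _ (0≤p : 0ℚ ≤ p) (p≤1 : p ≤ 1ℚ) {r : ℚ} (0≤r : 0ℚ ≤ pow r m) (δ-bound : pow (1ℚ - δ) m ≤ pow r m) where

      -- The base `r` replaces `1ℚ - δ`, which varies with the rational bias, by a number that will
      -- be common to all late terms of `p`.
      Prob-unresolved : ∀ xy → Prob (not ∘ resolved xy) ≤ pow r m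
      Prob-unresolved (x , y) with x ≟ y
      ... | yes _  = ℚ.≤-trans (ℚ.≤-reflexive (E-const {n} 0ℚ)) 0≤r
      ... | no x≢y =
        let x≢ρ , y≢ρ = proj₂ (avoid (class x) (class y)) in
        ℚ.≤-trans (ℚ.≤-reflexive (Prob-unseparated x≢y x≢ρ y≢ρ m ℕ.≤-refl)) δ-bound

      Prob-allResolved : Prob (not ∘ allResolved) ≤ fromℕℚ (n ℕ.* n) * pow r m
      Prob-allResolved = subst (λ k → Prob (not ∘ allResolved) ≤ fromℕℚ k * pow r m)
        (trans (length-cartesianProduct (allFin n) (allFin n))
          (cong₂ ℕ._*_ (length-tabulate {n = n} id) (length-tabulate {n = n} id)))
        (union-bound 0≤p p≤1 resolved (pow r m) Prob-unresolved (cartesianProduct (allFin n) (allFin n)))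

-- Rational estimates

fromℕℚ-mono : ∀ {m n} → m ℕ.≤ n → fromℕℚ m ≤ fromℕℚ n
fromℕℚ-mono m≤n = ℚ.*≤* (ℤ.*-monoʳ-≤-nonNeg (ℤ.+ 1) (ℤ.+≤+ m≤n))

fromℕℚ-+ : ∀ m n → fromℕℚ (m ℕ.+ n) ≡ fromℕℚ m + fromℕℚ n
fromℕℚ-+ zero    n = sym (ℚ.+-identityˡ _)
fromℕℚ-+ (suc m) n = begin
  fromℕℚ (suc (m ℕ.+ n))
    ≡⟨ fromℕℚ-suc (m ℕ.+ n) ⟩
  fromℕℚ (m ℕ.+ n) + 1ℚ
    ≡⟨ cong (_+ 1ℚ) (fromℕℚ-+ m n) ⟩
  fromℕℚ m + fromℕℚ n + 1ℚ
    ≡⟨ solve 2 (λ a b → a :+ b :+ con 1ℚ := a :+ con 1ℚ :+ b) refl (fromℕℚ m) (fromℕℚ n) ⟩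
  fromℕℚ m + 1ℚ + fromℕℚ n
    ≡⟨ cong (_+ fromℕℚ n) (fromℕℚ-suc m) ⟨
  fromℕℚ (suc m) + fromℕℚ n ∎
  where
  open ≡-Reasoning
  open ℚ-Solver

fromℕℚ-* : ∀ m n → fromℕℚ (m ℕ.* n) ≡ fromℕℚ m * fromℕℚ n
fromℕℚ-* zero    n = sym (ℚ.*-zeroˡ (fromℕℚ n))
fromℕℚ-* (suc m) n = begin
  fromℕℚ (n ℕ.+ m ℕ.* n)
    ≡⟨ fromℕℚ-+ n (m ℕ.* n) ⟩
  fromℕℚ n + fromℕℚ (m ℕ.* n)
    ≡⟨ cong (fromℕℚ n +_) (fromℕℚ-* m n) ⟩
  fromℕℚ n + fromℕℚ m * fromℕℚ n
    ≡⟨ solve 2 (λ a b → b :+ a :* b := (a :+ con 1ℚ) :* b) refl (fromℕℚ m) (fromℕℚ n) ⟩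
  (fromℕℚ m + 1ℚ) * fromℕℚ n
    ≡⟨ cong (_* fromℕℚ n) (fromℕℚ-suc m) ⟨
  fromℕℚ (suc m) * fromℕℚ n ∎
  where
  open ≡-Reasoning
  open ℚ-Solver

fromℕℚ*recip : ∀ k → fromℕℚ (suc k) * recip k ≡ 1ℚ
fromℕℚ*recip k = trans (cong (λ z → fromℕℚ (suc k) * recip z) (sym (ℕ.+-identityʳ k))) (recip-split 0 k)

*-mono-≤-nonNeg : ∀ {a b c d} → 0ℚ ≤ a → 0ℚ ≤ d → a ≤ b → c ≤ d → a * c ≤ b * d
*-mono-≤-nonNeg {a} {b} {c} {d} 0≤a 0≤d a≤b c≤d = ℚ.≤-trans
  (ℚ.*-monoˡ-≤-nonNeg a {{nonNegative 0≤a}} c≤d) (ℚ.*-monoʳ-≤-nonNeg d {{nonNegative 0≤d}} a≤b)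

*-nonNeg : ∀ {a b} → 0ℚ ≤ a → 0ℚ ≤ b → 0ℚ ≤ a * b
*-nonNeg {a} {b} 0≤a 0≤b = subst (_≤ a * b) (ℚ.*-zeroʳ a)
  (ℚ.*-monoˡ-≤-nonNeg a {{nonNegative 0≤a}} 0≤b)

pow-nonNeg : ∀ {x} k → 0ℚ ≤ x → 0ℚ ≤ pow x k
pow-nonNeg zero    0≤x = 0≤1ℚ
pow-nonNeg (suc k) 0≤x = *-nonNeg 0≤x (pow-nonNeg k 0≤x)

pow-mono : ∀ {x y} k → 0ℚ ≤ x → x ≤ y → pow x k ≤ pow y k
pow-mono zero    0≤x x≤y = ℚ.≤-refl
pow-mono (suc k) 0≤x x≤y =
  *-mono-≤-nonNeg 0≤x (pow-nonNeg k (ℚ.≤-trans 0≤x x≤y)) x≤y (pow-mono k 0≤x x≤y)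

pow-+ : ∀ x a b → pow x (a ℕ.+ b) ≡ pow x a * pow x b
pow-+ x zero    b = sym (ℚ.*-identityˡ _)
pow-+ x (suc a) b = trans (cong (x *_) (pow-+ x a b)) (sym (ℚ.*-assoc x _ _))

pow-* : ∀ x a b → pow x (b ℕ.* a) ≡ pow (pow x a) b
pow-* x a zero    = refl
pow-* x a (suc b) = trans (pow-+ x a (b ℕ.* a)) (cong (pow x a *_) (pow-* x a b))

2^k*½^k : ∀ k → fromℕℚ (2 ^ k) * pow ½ k ≡ 1ℚ
2^k*½^k zero    = refl
2^k*½^k (suc k) = begin
  fromℕℚ (2 ℕ.* 2 ^ k) * (½ * pow ½ k)
    ≡⟨ cong (_* (½ * pow ½ k)) (fromℕℚ-* 2 (2 ^ k)) ⟩
  (fromℕℚ 2 * fromℕℚ (2 ^ k)) * (½ * pow ½ k)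
    ≡⟨ solve 4 (λ a b c d → (a :* b) :* (c :* d) := (a :* c) :* (b :* d)) refl (fromℕℚ 2) (fromℕℚ (2 ^ k)) ½ (pow ½ k) ⟩
  (fromℕℚ 2 * ½) * (fromℕℚ (2 ^ k) * pow ½ k)
    ≡⟨ cong ((fromℕℚ 2 * ½) *_) (2^k*½^k k) ⟩
  fromℕℚ 2 * ½ * 1ℚ
    ≡⟨⟩
  1ℚ ∎
  where
  open ≡-Reasoning
  open ℚ-Solver

½-nonNeg : 0ℚ ≤ ½
½-nonNeg = ℚ.nonNegative⁻¹ ½

≤2^k⇒*½^k≤1 : ∀ {n} k → n ℕ.≤ 2 ^ k → fromℕℚ n * pow ½ k ≤ 1ℚ
≤2^k⇒*½^k≤1 {n} k n≤2^k = ℚ.≤-trans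
  (ℚ.*-monoʳ-≤-nonNeg (pow ½ k) {{nonNegative (pow-nonNeg k ½-nonNeg)}} (fromℕℚ-mono n≤2^k))
  (ℚ.≤-reflexive (2^k*½^k k))

1+k≤2^k : ∀ k → suc k ℕ.≤ 2 ^ k
1+k≤2^k zero    = s≤s z≤n
1+k≤2^k (suc k) = subst (suc (suc k) ℕ.≤_) (cong (2 ^ k ℕ.+_) (sym (ℕ.+-identityʳ (2 ^ k))))
  (ℕ.+-mono-≤ (ℕ.m^n>0 2 k) (1+k≤2^k k))

-- The weaker rate 1/(k + 1) is enough for the limit and can be compared with any positive rational
-- by `archimedean`.
½^k≤recip : ∀ k → pow ½ k ≤ recip k
½^k≤recip k = begin
  pow ½ k
    ≡⟨ ℚ.*-identityˡ (pow ½ k) ⟨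
  1ℚ * pow ½ k
    ≡⟨ cong (_* pow ½ k) (fromℕℚ*recip k) ⟨
  fromℕℚ (suc k) * recip k * pow ½ k
    ≡⟨ solve 3 (λ a b c → a :* b :* c := b :* (a :* c)) refl (fromℕℚ (suc k)) (recip k) (pow ½ k) ⟩
  recip k * (fromℕℚ (suc k) * pow ½ k)
    ≤⟨ ℚ.*-monoˡ-≤-nonNeg (recip k) (≤2^k⇒*½^k≤1 k (1+k≤2^k k)) ⟩
  recip k * 1ℚ
    ≡⟨ ℚ.*-identityʳ (recip k) ⟩
  recip k ∎
  where
  open ℚ.≤-Reasoning
  open ℚ-Solver

-- This is the upper bound 1/(1 + kx) for (1 - x)^k, free of division. The induction rests on (1 -
-- x)(1 + (k + 1)x) = 1 + kx - (k + 1)x².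
bernoulli : ∀ {x} k → 0ℚ ≤ x → x ≤ 1ℚ → pow (1ℚ - x) k * (1ℚ + fromℕℚ k * x) ≤ 1ℚ
bernoulli {x} zero    0≤x x≤1 = ℚ.≤-reflexive
  (solve 1 (λ x → con 1ℚ :* (con 1ℚ :+ con 0ℚ :* x) := con 1ℚ) refl x)
  where
  open ℚ-Solver
bernoulli {x} (suc k) 0≤x x≤1 = begin
  y * pow y k * (1ℚ + fromℕℚ (suc k) * x)
    ≡⟨ cong (λ z → y * pow y k * (1ℚ + z * x)) (fromℕℚ-suc k) ⟩
  y * pow y k * (1ℚ + (fromℕℚ k + 1ℚ) * x)
    ≡⟨ solve 3 (λ x w k → (con 1ℚ :- x) :* w :* (con 1ℚ :+ (k :+ con 1ℚ) :* x) :=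
         w :* (con 1ℚ :+ k :* x) :- w :* ((k :+ con 1ℚ) :* (x :* x))) refl x (pow y k) (fromℕℚ k) ⟩
  pow y k * (1ℚ + fromℕℚ k * x) - pow y k * ((fromℕℚ k + 1ℚ) * (x * x))
    ≤⟨ ℚ.+-mono-≤ (bernoulli k 0≤x x≤1) (ℚ.neg-antimono-≤ (*-nonNeg (pow-nonNeg k (complement-nonNeg x≤1))
         (*-nonNeg (ℚ.+-mono-≤ (ℚ.nonNegative⁻¹ (fromℕℚ k)) 0≤1ℚ) (*-nonNeg 0≤x 0≤x)))) ⟩
  1ℚ - 0ℚ
    ≡⟨ ℚ.+-identityʳ 1ℚ ⟩
  1ℚ ∎
  where
  open ℚ.≤-Reasoning
  open ℚ-Solver
  y = 1ℚ - x

recip≤1 : ∀ k → recip k ≤ 1ℚ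
recip≤1 k = recip-anti {0} {k} z≤n

decay : ℕ → ℚ
decay k = 1ℚ - recip k

decay-nonNeg : ∀ k → 0ℚ ≤ decay k
decay-nonNeg k = complement-nonNeg (recip≤1 k)

-- With x = 1/(k + 1) and exponent k + 1 the factor in `bernoulli` equals 2.
decay-pow≤½ : ∀ k → pow (decay k) (suc k) ≤ ½
decay-pow≤½ k = begin
  d
    ≡⟨ solve 1 (λ d → d := d :* (con 1ℚ :+ con 1ℚ) :* con ½) refl d ⟩
  d * (1ℚ + 1ℚ) * ½
    ≡⟨ cong (λ z → d * (1ℚ + z) * ½) (fromℕℚ*recip k) ⟨
  d * (1ℚ + fromℕℚ (suc k) * recip k) * ½
    ≤⟨ ℚ.*-monoʳ-≤-nonNeg ½ (bernoulli (suc k) (ℚ.<⇒≤ (recip-pos k)) (recip≤1 k)) ⟩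
  1ℚ * ½
    ≡⟨⟩
  ½ ∎
  where
  open ℚ.≤-Reasoning
  open ℚ-Solver
  d = pow (decay k) (suc k)

-- Logarithms

harmonic-mono : ∀ a {M N} → M ℕ.≤ N → harmonic a M ≤ harmonic a N
harmonic-mono a {M} {N} M≤N = begin
  harmonic a M                                  ≡⟨ ℚ.+-identityʳ _ ⟨
  harmonic a M + 0ℚ                             ≤⟨ ℚ.+-monoʳ-≤ (harmonic a M) (nonNeg (N ℕ.∸ M)) ⟩
  harmonic a M + harmonic (a ℕ.+ M) (N ℕ.∸ M)   ≡⟨ harmonic-+ a M (N ℕ.∸ M) ⟨
  harmonic a (M ℕ.+ (N ℕ.∸ M))                  ≡⟨ cong (harmonic a) (ℕ.m+[n∸m]≡n M≤N) ⟩
  harmonic a N                                  ∎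
  where
  open ℚ.≤-Reasoning
  nonNeg : ∀ K → 0ℚ ≤ harmonic (a ℕ.+ M) K
  nonNeg K = begin
    0ℚ                  ≡⟨ ℚ.*-zeroʳ (fromℕℚ K) ⟨
    fromℕℚ K * 0ℚ       ≡⟨ sumℚ-const K 0ℚ ⟨
    sumℚ K (λ _ → 0ℚ)   ≤⟨ sumℚ-mono K (λ i _ → ℚ.<⇒≤ (recip-pos (a ℕ.+ M ℕ.+ i))) ⟩
    harmonic (a ℕ.+ M) K ∎

logSeq-mono : ∀ {m n} k → m ℕ.≤ n → logSeq m k ≤ logSeq n k
logSeq-mono k m≤n = harmonic-mono (suc k) (ℕ.*-monoˡ-≤ (suc k) (ℕ.∸-monoˡ-≤ 1 m≤n))

-- The sum 1/(a + 1) + ... + 1/(2a) approximates log 2. Comparing its `a` terms with 1/a gives the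
-- bound 1, and with 1/(2a) the bound ½ of the next lemma.
harmonic-octave-≤1 : ∀ a .{{_ : ℕ.NonZero a}} → harmonic a a ≤ 1ℚ
harmonic-octave-≤1 (suc b) = begin
  harmonic (suc b) (suc b)
    ≤⟨ sumℚ-mono (suc b) (λ i _ → recip-anti (ℕ.≤-trans (ℕ.n≤1+n b) (ℕ.m≤m+n (suc b) i))) ⟩
  sumℚ (suc b) (λ _ → recip b)
    ≡⟨ sumℚ-const (suc b) (recip b) ⟩
  fromℕℚ (suc b) * recip b
    ≡⟨ fromℕℚ*recip b ⟩
  1ℚ ∎
  where
  open ℚ.≤-Reasoning

harmonic-octave-≥½ : ∀ a .{{_ : ℕ.NonZero a}} → ½ ≤ harmonic a a
harmonic-octave-≥½ (suc b) = begin
  ½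
    ≡⟨ recip-split 1 b ⟨
  fromℕℚ (suc b) * recip (b ℕ.+ 1 ℕ.* suc b)
    ≡⟨ sumℚ-const (suc b) _ ⟨
  sumℚ (suc b) (λ _ → recip (b ℕ.+ 1 ℕ.* suc b))
    ≤⟨ sumℚ-mono (suc b) (λ i i<a → recip-anti (i-bound i i<a)) ⟩
  harmonic (suc b) (suc b) ∎
  where
  open ℚ.≤-Reasoning
  i-bound : ∀ i → i ℕ.< suc b → suc b ℕ.+ i ℕ.≤ b ℕ.+ 1 ℕ.* suc b
  i-bound i (s≤s i≤b) = subst (suc b ℕ.+ i ℕ.≤_)
    (solve 1 (λ b → con 1 :+ b :+ b := b :+ con 1 :* (con 1 :+ b)) refl b)
    (ℕ.+-monoʳ-≤ (suc b) i≤b)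
    where
    open ℕ-Solver

-- The interval of integration is cut at 2^t. With K = `suc k` the left part has the denominators K
-- + 1 to 2^t K, and the right part the next 2^t K ones. Writing 2^t as a successor makes the
-- truncated subtraction compute.
logSeq-double : ∀ t k → logSeq (2 ^ suc t) k ≡ logSeq (2 ^ t) k + harmonic (2 ^ t ℕ.* suc k) (2 ^ t ℕ.* suc k)
logSeq-double t k with 2 ^ t | ℕ.m^n>0 2 t
... | suc a | _ = trans
  (cong (harmonic (suc k)) (solve 2 (λ a K → (a :+ (con 1 :+ a :+ con 0)) :* K := a :* K :+ (con 1 :+ a) :* K)
    refl a (suc k)))
  (harmonic-+ (suc k) (a ℕ.* suc k) (suc a ℕ.* suc k))
  where
  open ℕ-Solver

2^t*1+k≢0 : ∀ t k → ℕ.NonZero (2 ^ t ℕ.* suc k)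
2^t*1+k≢0 t k = ℕ.m*n≢0 (2 ^ t) (suc k) {{ℕ.m^n≢0 2 t}}

logSeq-2^-≤ : ∀ t k → logSeq (2 ^ t) k ≤ fromℕℚ t
logSeq-2^-≤ zero    k = ℚ.≤-refl
logSeq-2^-≤ (suc t) k = begin
  logSeq (2 ^ suc t) k
    ≡⟨ logSeq-double t k ⟩
  logSeq (2 ^ t) k + harmonic (2 ^ t ℕ.* suc k) (2 ^ t ℕ.* suc k)
    ≤⟨ ℚ.+-mono-≤ (logSeq-2^-≤ t k) (harmonic-octave-≤1 _ {{2^t*1+k≢0 t k}}) ⟩
  fromℕℚ t + 1ℚ
    ≡⟨ fromℕℚ-suc t ⟨
  fromℕℚ (suc t) ∎
  where
  open ℚ.≤-Reasoning

logSeq-2^-≥ : ∀ t k → fromℕℚ t * ½ ≤ logSeq (2 ^ t) k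
logSeq-2^-≥ zero    k = ℚ.≤-refl
logSeq-2^-≥ (suc t) k = begin
  fromℕℚ (suc t) * ½     ≡⟨ cong (_* ½) (fromℕℚ-suc t) ⟩
  (fromℕℚ t + 1ℚ) * ½    ≡⟨ ℚ.*-distribʳ-+ ½ (fromℕℚ t) 1ℚ ⟩
  fromℕℚ t * ½ + ½       ≤⟨ ℚ.+-mono-≤ (logSeq-2^-≥ t k) (harmonic-octave-≥½ _ {{2^t*1+k≢0 t k}}) ⟩
  logSeq (2 ^ t) k + harmonic (2 ^ t ℕ.* suc k) (2 ^ t ℕ.* suc k) ≡⟨ logSeq-double t k ⟨
  logSeq (2 ^ suc t) k   ∎
  where
  open ℚ.≤-Reasoning

floorLog : ∀ n → Σ[ L ∈ ℕ ] 2 ^ L ℕ.≤ suc n × suc n ℕ.< 2 ^ suc L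
floorLog zero = 0 , s≤s z≤n , s≤s (s≤s z≤n)
floorLog (suc n) with L , lower , upper ← floorLog n | suc (suc n) ℕ.<? 2 ^ suc L
... | yes below = L , ℕ.m≤n⇒m≤1+n lower , below
... | no ¬below = suc L , ℕ.≮⇒≥ ¬below , ℕ.≤-<-trans upper (ℕ.^-monoʳ-< 2 (s≤s (s≤s z≤n)) (ℕ.n<1+n (suc L)))

2^-cancel-< : ∀ {a b} → 2 ^ a ℕ.< 2 ^ b → a ℕ.< b
2^-cancel-< 2^a<2^b = ℕ.≰⇒> λ b≤a → ℕ.<⇒≱ 2^a<2^b (ℕ.^-monoʳ-≤ 2 b≤a)

-- The induction starts at 4 because 3² exceeds 2³; the polynomial added in the step is 2(4 + i)² -
-- (5 + i)².
square≤2^ : ∀ i → (4 ℕ.+ i) ℕ.* (4 ℕ.+ i) ℕ.≤ 2 ^ (4 ℕ.+ i)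
square≤2^ zero    = ℕ.≤-refl
square≤2^ (suc i) = begin
  (5 ℕ.+ i) ℕ.* (5 ℕ.+ i)
    ≤⟨ ℕ.m≤m+n _ (i ℕ.* i ℕ.+ 6 ℕ.* i ℕ.+ 7) ⟩
  (5 ℕ.+ i) ℕ.* (5 ℕ.+ i) ℕ.+ (i ℕ.* i ℕ.+ 6 ℕ.* i ℕ.+ 7)
    ≡⟨ solve 1 (λ i → (con 5 :+ i) :* (con 5 :+ i) :+ (i :* i :+ con 6 :* i :+ con 7) :=
                     con 2 :* ((con 4 :+ i) :* (con 4 :+ i))) refl i ⟩
  2 ℕ.* ((4 ℕ.+ i) ℕ.* (4 ℕ.+ i))
    ≤⟨ ℕ.*-monoʳ-≤ 2 (square≤2^ i) ⟩
  2 ^ (5 ℕ.+ i) ∎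
  where
  open ℕ.≤-Reasoning
  open ℕ-Solver

linear≤2^ : ∀ {B L} → B ℕ.≤ L → 4 ℕ.≤ L → B ℕ.* L ℕ.≤ 2 ^ L
linear≤2^ {B} {L} B≤L 4≤L = ℕ.≤-trans (ℕ.*-monoˡ-≤ L B≤L)
  (subst (λ L → L ℕ.* L ℕ.≤ 2 ^ L) (ℕ.m+[n∸m]≡n 4≤L) (square≤2^ (L ℕ.∸ 4)))

-- Real numbers

≤ᴿ-termwise : ∀ {x y} → (∀ k → seq x k ≤ seq y k) → x ≤ᴿ y
≤ᴿ-termwise {x} {y} x≤y (ε , 0<ε , N , h) = ℚ.<-irrefl refl (ℚ.<-≤-trans 0<ε (begin
  ε                             ≡⟨ solve 2 (λ a e → e := a :+ e :- a) refl (seq y N) ε ⟩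
  seq y N + ε - seq y N         ≤⟨ ℚ.+-monoˡ-≤ (ℚ.- seq y N) (ℚ.≤-trans (h N ℕ.≤-refl) (x≤y N)) ⟩
  seq y N - seq y N             ≡⟨ ℚ.+-inverseʳ (seq y N) ⟩
  0ℚ                            ∎))
  where
  open ℚ.≤-Reasoning
  open ℚ-Solver

0<fromℚ : ∀ {q} → 0ℚ < q → 0ᴿ <ᴿ fromℚ q
0<fromℚ {q} 0<q = q , 0<q , 0 , λ _ _ → ℚ.≤-reflexive (ℚ.+-identityˡ q)

module _ (p : ℝ) (k : ℕ) where
  open Expectation (seq p k)

  seq-massVec : ∀ {n} (r : Vec Bool n) → seq (massVec p r) k ≡ massVecℚ r
  seq-massVec []          = refl
  seq-massVec (true  ∷ r) = cong (weight true *_) (seq-massVec r)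
  seq-massVec (false ∷ r) = cong (weight false *_) (seq-massVec r)

  seq-mass : ∀ {n} (c : Coins n) → seq (mass p c) k ≡ massℚ c
  seq-mass []      = refl
  seq-mass (r ∷ c) = cong₂ _*_ (seq-massVec r) (seq-mass c)

  seq-sum : {A : Set} (f : A → ℝ) (xs : List A) →
    seq (foldr _+ᴿ_ 0ᴿ (map f xs)) k ≡ sumOver (λ x → seq (f x) k) xs
  seq-sum f []       = refl
  seq-sum f (x ∷ xs) = cong (seq (f x) k +_) (seq-sum f xs)

  -- This is the passage from real to rational probabilities: `Pr` is built from termwise operations
  -- only.
  seq-Pr : ∀ {n} (S : Coins n → Bool) → seq (Pr p S) k ≡ Prob S
  seq-Pr {n} S = trans (seq-sum (λ c → if S c then mass p c else 0ᴿ) (allCoins n))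
    (trans (sumOver-cong term (allCoins n)) (E-sum λ c → when (S c) 1ℚ))
    where
    term : ∀ c → seq (if S c then mass p c else 0ᴿ) k ≡ massℚ c * when (S c) 1ℚ
    term c with S c
    ... | true  = trans (seq-mass c) (sym (ℚ.*-identityʳ (massℚ c)))
    ... | false = sym (ℚ.*-zeroʳ (massℚ c))

-- The bounds

+-nonNeg-cancel-≤ : ∀ {a b c} → a + b ≤ c → 0ℚ ≤ b → a ≤ c
+-nonNeg-cancel-≤ {a} {b} a+b≤c 0≤b =
  ℚ.≤-trans (subst (_≤ a + b) (ℚ.+-identityʳ a) (ℚ.+-monoʳ-≤ a 0≤b)) a+b≤c

+≤1⇒≤1- : ∀ {a b} → a + b ≤ 1ℚ → b ≤ 1ℚ - a
+≤1⇒≤1- {a} {b} a+b≤1 = subst (_≤ 1ℚ - a) (solve 2 (λ a b → a :+ b :- a := b) refl a b)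
  (ℚ.+-monoˡ-≤ (ℚ.- a) a+b≤1)
  where
  open ℚ-Solver

1-antimono : ∀ {a b} → a ≤ b → 1ℚ - b ≤ 1ℚ - a
1-antimono a≤b = ℚ.+-monoʳ-≤ 1ℚ (ℚ.neg-antimono-≤ a≤b)

1-≤1 : ∀ {a} → 0ℚ ≤ a → 1ℚ - a ≤ 1ℚ
1-≤1 = 1-antimono

p³q²-mono : ∀ {p q p′ q′} → 0ℚ ≤ p → 0ℚ ≤ q → p ≤ p′ → q ≤ q′ → p³q² p q ≤ p³q² p′ q′
p³q²-mono {p} {q} {p′} {q′} 0≤p 0≤q p≤ q≤ =
  times 0≤p p≤ (n p≥ (n q≥ (n p≥ (n q≥ 0≤1ℚ)))) (times 0≤p p≤ (n q≥ (n p≥ (n q≥ 0≤1ℚ)))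
    (times 0≤q q≤ (n p≥ (n q≥ 0≤1ℚ)) (times 0≤p p≤ (n q≥ 0≤1ℚ) (times 0≤q q≤ 0≤1ℚ ℚ.≤-refl))))
  where
  n : ∀ {a b} → 0ℚ ≤ a → 0ℚ ≤ b → 0ℚ ≤ a * b
  n = *-nonNeg
  p≥ = ℚ.≤-trans 0≤p p≤
  q≥ = ℚ.≤-trans 0≤q q≤
  times : ∀ {a b c d} → 0ℚ ≤ a → a ≤ b → 0ℚ ≤ d → c ≤ d → a * c ≤ b * d
  times 0≤a a≤b 0≤d c≤d = *-mono-≤-nonNeg 0≤a 0≤d a≤b c≤d

p³q²-pos : ∀ {p q} → 0ℚ < p → 0ℚ < q → 0ℚ < p³q² p q
p³q²-pos 0<p 0<q = pos 0<p (pos 0<p (pos 0<q (pos 0<p (pos 0<q (ℚ.positive⁻¹ 1ℚ)))))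
  where
  pos : ∀ {a b} → 0ℚ < a → 0ℚ < b → 0ℚ < a * b
  pos {a} {b} 0<a 0<b = ℚ.positive⁻¹ (a * b) {{ℚ.pos*pos⇒pos a {{ℚ.positive 0<a}} b {{ℚ.positive 0<b}}}}

-- Every `suc N₀` pairs halve the failure probability. Of the 5L halvings, 2L absorb one factor n,
-- another 2L the second, and the last L make the bound tend to 0.
n²-decay : ∀ {n L} N₀ → n ℕ.≤ 2 ^ (L ℕ.+ L) →
  fromℕℚ (n ℕ.* n) * pow (decay N₀) ((L ℕ.* 5) ℕ.* suc N₀) ≤ recip L
n²-decay {n} {L} N₀ n≤4^L = begin
  fromℕℚ (n ℕ.* n) * pow (decay N₀) ((L ℕ.* 5) ℕ.* suc N₀)
    ≡⟨ cong₂ _*_ (fromℕℚ-* n n) (pow-* (decay N₀) (suc N₀) (L ℕ.* 5)) ⟩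
  (fromℕℚ n * fromℕℚ n) * pow (pow (decay N₀) (suc N₀)) (L ℕ.* 5)
    ≤⟨ ℚ.*-monoˡ-≤-nonNeg (fromℕℚ n * fromℕℚ n) {{nonNegative (*-nonNeg 0≤n 0≤n)}}
         (pow-mono (L ℕ.* 5) (pow-nonNeg (suc N₀) (decay-nonNeg N₀)) (decay-pow≤½ N₀)) ⟩
  (fromℕℚ n * fromℕℚ n) * pow ½ (L ℕ.* 5)
    ≡⟨ cong ((fromℕℚ n * fromℕℚ n) *_) (trans (cong (pow ½) (five L))
         (trans (pow-+ ½ (L ℕ.+ L) _) (cong (h *_) (pow-+ ½ (L ℕ.+ L) L)))) ⟩
  (fromℕℚ n * fromℕℚ n) * (h * (h * pow ½ L))
    ≡⟨ rearrange (fromℕℚ n) h (pow ½ L) ⟩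
  (fromℕℚ n * h) * ((fromℕℚ n * h) * pow ½ L)
    ≤⟨ *-mono-≤-nonNeg 0≤nh (*-nonNeg 0≤1ℚ 0≤½^L) nh≤1 (*-mono-≤-nonNeg 0≤nh 0≤½^L nh≤1 ℚ.≤-refl) ⟩
  1ℚ * (1ℚ * pow ½ L)
    ≡⟨ trans (ℚ.*-identityˡ _) (ℚ.*-identityˡ _) ⟩
  pow ½ L
    ≤⟨ ½^k≤recip L ⟩
  recip L ∎
  where
  open ℚ.≤-Reasoning
  h : ℚ
  h = pow ½ (L ℕ.+ L)
  0≤n : 0ℚ ≤ fromℕℚ n
  0≤n = ℚ.nonNegative⁻¹ (fromℕℚ n)
  0≤½^L : 0ℚ ≤ pow ½ L
  0≤½^L = pow-nonNeg L ½-nonNeg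
  0≤nh : 0ℚ ≤ fromℕℚ n * h
  0≤nh = *-nonNeg 0≤n (pow-nonNeg (L ℕ.+ L) ½-nonNeg)
  nh≤1 : fromℕℚ n * h ≤ 1ℚ
  nh≤1 = ≤2^k⇒*½^k≤1 (L ℕ.+ L) n≤4^L
  five : ∀ L → L ℕ.* 5 ≡ (L ℕ.+ L) ℕ.+ ((L ℕ.+ L) ℕ.+ L)
  five = solve 1 (λ L → L :* con 5 := (L :+ L) :+ ((L :+ L) :+ L)) refl
    where
    open ℕ-Solver
  rearrange : ∀ a b c → (a * a) * (b * (b * c)) ≡ (a * b) * ((a * b) * c)
  rearrange = solve 3 (λ a b c → (a :* a) :* (b :* (b :* c)) := (a :* b) :* ((a :* b) :* c)) refl
    where
    open ℚ-Solver

-- The event, and the orders of magnitude that it implies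

module Construction (N₀ : ℕ) where

  L : ℕ → ℕ
  L n = proj₁ (floorLog n)

  m : ℕ → ℕ
  m n = (L n ℕ.* 5) ℕ.* suc N₀

  -- Three classes of 5L(N₀ + 1) pairs make `D` L queries, and `recip d` is 1/D. The pairs occupy
  -- 30(N₀ + 1)L vertices; once L is at least `threshold`, this is at most L², hence at most 2^L,
  -- where L ≥ 4 is used.
  d D threshold : ℕ
  d = 14 ℕ.+ 15 ℕ.* N₀
  D = suc d
  threshold = 4 ℕ.+ 30 ℕ.* suc N₀

  3m≡DL : ∀ n → 3 ℕ.* m n ≡ D ℕ.* L n
  3m≡DL n = trans
    (solve 4 (λ a b L M → a :* ((L :* b) :* M) := (a :* b :* M) :* L) refl 3 5 (L n) (suc N₀))
    (cong (ℕ._* L n) (ℕ.*-suc 15 N₀))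
    where
    open ℕ-Solver

  room? : ∀ n → Dec (m n ℕ.* 6 ℕ.≤ suc n)
  room? n = m n ℕ.* 6 ℕ.≤? suc n

  -- For small n the pairs do not fit and the event is empty, which the limit ignores.
  resolvedBy : ∀ n → Dec (m n ℕ.* 6 ℕ.≤ suc n) → Coins (suc n) → Bool
  resolvedBy n (yes room) = Separation.allResolved (standardPairs n (m n) room)
  resolvedBy n (no _)   _ = false

  event : ∀ n → Coins n → Bool
  event zero    _ = false
  event (suc n)   = resolvedBy n (room? n)

  resolvedBy⇒numbers : ∀ n room c → T (resolvedBy n room c) → QueryNumbers (graph c) (D ℕ.* L n)
  resolvedBy⇒numbers n (yes room) c all-resolved =
    subst (QueryNumbers (graph c)) (trans length-queries (3m≡DL n))
      (queryNumbers (graph c) queries (allResolved⇒separated c all-resolved))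
    where
    open Separation (standardPairs n (m n) room)

  -- The constants come from eq ≤ DL ≤ D pq, from log n ≤ log 2^pq ≤ pq ≤ eq, and from L/2 ≤ log 2^L
  -- ≤ log n.
  QueryOrder : ∀ n → SimpleGraph n → Set
  QueryOrder n G = Σ[ pq ∈ ℕ ] Σ[ eq ∈ ℕ ] IsPq G pq × IsEq G eq ×
    Between (fromℚ (recip d)) 1ᴿ (fromℕ eq) (fromℕ pq) ×
    Between 1ᴿ (fromℕ (D ℕ.+ D)) (log n) (fromℕ eq)

  numbers⇒order : ∀ n (G : SimpleGraph (suc n)) → QueryNumbers G (D ℕ.* L n) → QueryOrder (suc n) G
  numbers⇒order n G numbers = pq , eq , isPq , isEq ,
    (≤ᴿ-termwise {fromℚ (recip d) *ᴿ fromℕ eq} {fromℕ pq} (λ _ → eq/D≤pq) ,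
     ≤ᴿ-termwise {fromℕ pq} {1ᴿ *ᴿ fromℕ eq} (λ _ → ℚ.≤-trans (fromℕℚ-mono pq≤eq) (ℚ.≤-reflexive (sym (ℚ.*-identityˡ _))))) ,
    (≤ᴿ-termwise {1ᴿ *ᴿ log (suc n)} {fromℕ eq} log≤eq ,
     ≤ᴿ-termwise {fromℕ eq} {fromℕ (D ℕ.+ D) *ᴿ log (suc n)} eq≤2Dlog)
    where
    open QueryNumbers numbers
    open ℚ.≤-Reasoning
    open ℚ-Solver
    L≤pq : L n ℕ.≤ pq
    L≤pq = ℕ.≮⇒≥ λ pq<L → ℕ.<⇒≱ (ℕ.^-monoʳ-< 2 (s≤s (s≤s z≤n)) pq<L)
      (ℕ.≤-trans (proj₁ (proj₂ (floorLog n))) n≤2^pq)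
    eq/D≤pq : recip d * fromℕℚ eq ≤ fromℕℚ pq
    eq/D≤pq = begin
      recip d * fromℕℚ eq
        ≤⟨ ℚ.*-monoˡ-≤-nonNeg (recip d) (fromℕℚ-mono (ℕ.≤-trans eq≤m (ℕ.*-monoʳ-≤ D L≤pq))) ⟩
      recip d * fromℕℚ (D ℕ.* pq)
        ≡⟨ cong (recip d *_) (fromℕℚ-* D pq) ⟩
      recip d * (fromℕℚ D * fromℕℚ pq)
        ≡⟨ solve 3 (λ a b c → a :* (b :* c) := (b :* a) :* c) refl (recip d) (fromℕℚ D) (fromℕℚ pq) ⟩
      fromℕℚ D * recip d * fromℕℚ pq
        ≡⟨ cong (_* fromℕℚ pq) (fromℕℚ*recip d) ⟩
      1ℚ * fromℕℚ pq
        ≡⟨ ℚ.*-identityˡ (fromℕℚ pq) ⟩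
      fromℕℚ pq ∎
    log≤eq : ∀ k → 1ℚ * logSeq (suc n) k ≤ fromℕℚ eq
    log≤eq k = begin
      1ℚ * logSeq (suc n) k             ≡⟨ ℚ.*-identityˡ _ ⟩
      logSeq (suc n) k                  ≤⟨ logSeq-mono k n≤2^pq ⟩
      logSeq (2 ^ pq) k                 ≤⟨ logSeq-2^-≤ pq k ⟩
      fromℕℚ pq                         ≤⟨ fromℕℚ-mono pq≤eq ⟩
      fromℕℚ eq                         ∎
    eq≤2Dlog : ∀ k → fromℕℚ eq ≤ fromℕℚ (D ℕ.+ D) * logSeq (suc n) k
    eq≤2Dlog k = begin
      fromℕℚ eq
        ≤⟨ fromℕℚ-mono eq≤m ⟩
      fromℕℚ (D ℕ.* L n)
        ≡⟨ fromℕℚ-* D (L n) ⟩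
      fromℕℚ D * fromℕℚ (L n)
        ≡⟨ solve 2 (λ a b → a :* b := (a :+ a) :* (b :* con ½)) refl (fromℕℚ D) (fromℕℚ (L n)) ⟩
      (fromℕℚ D + fromℕℚ D) * (fromℕℚ (L n) * ½)
        ≡⟨ cong (_* (fromℕℚ (L n) * ½)) (fromℕℚ-+ D D) ⟨
      fromℕℚ (D ℕ.+ D) * (fromℕℚ (L n) * ½)
        ≤⟨ ℚ.*-monoˡ-≤-nonNeg (fromℕℚ (D ℕ.+ D)) (ℚ.≤-trans (logSeq-2^-≥ (L n) k) (logSeq-mono k (proj₁ (proj₂ (floorLog n))))) ⟩
      fromℕℚ (D ℕ.+ D) * logSeq (suc n) k ∎

  event⇒order : ∀ n c → T (event n c) → QueryOrder n (graph c)
  event⇒order (suc n) c ev = numbers⇒order n (graph c) (resolvedBy⇒numbers n (room? n) c ev)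

  module _ {p : ℚ} (0≤p : 0ℚ ≤ p) (p≤1 : p ≤ 1ℚ) (recip≤δ : recip N₀ ≤ p³q² p (1ℚ - p)) where
    open Expectation p

    δ≤1 : p³q² p (1ℚ - p) ≤ 1ℚ
    -- The right-hand side is `p³q² 1ℚ 1ℚ`, which evaluates to 1.
    δ≤1 = p³q²-mono 0≤p (complement-nonNeg p≤1) p≤1 (1-≤1 0≤p)

    Prob-resolvedBy : ∀ n room → m n ℕ.* 6 ℕ.≤ suc n → 1 ℕ.≤ L n →
      Prob (not ∘ resolvedBy n room) ≤ recip (L n)
    Prob-resolvedBy n (no ¬room) room 1≤L = contradiction room ¬room
    Prob-resolvedBy n (yes room) _ 1≤L = ℚ.≤-trans
      (Bound.Prob-allResolved p 0≤p p≤1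
        (pow-nonNeg (m n) (decay-nonNeg N₀))
        (pow-mono (m n) (complement-nonNeg δ≤1) (1-antimono recip≤δ)))
      -- Since L ≥ 1, the upper bound 2^(L + 1) on the number of vertices is at most 2^(2L).
      (n²-decay {L = L n} N₀ (ℕ.≤-trans (ℕ.<⇒≤ (proj₂ (proj₂ (floorLog n))))
        (ℕ.^-monoʳ-≤ 2 (ℕ.+-monoˡ-≤ (L n) 1≤L))))
      where
      open Separation (standardPairs n (m n) room)

    -- `A` sets the precision: L ≥ A turns the failure bound 1/(L + 1) into 1/(A + 1), and L ≥
    -- `threshold` makes room for the pairs.
    Prob-event : ∀ n A → 2 ^ (A ℕ.⊔ threshold) ℕ.≤ suc n → 1ℚ - recip A ≤ Prob (event (suc n))
    Prob-event n A large = begin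
      1ℚ - recip A
        ≤⟨ 1-antimono (ℚ.≤-trans
        (Prob-resolvedBy n (room? n) room (ℕ.≤-trans (s≤s z≤n) (ℕ.≤-trans (ℕ.m≤m+n 4 _) threshold≤L)))
        (recip-anti A≤L)) ⟩
      1ℚ - Prob (not ∘ event (suc n))
        ≡⟨ cong (_- Prob (not ∘ event (suc n))) (Prob-not (event (suc n))) ⟨
      Prob (event (suc n)) + Prob (not ∘ event (suc n)) - Prob (not ∘ event (suc n))
        ≡⟨ solve 2 (λ a b → a :+ b :- b := a) refl (Prob (event (suc n))) (Prob (not ∘ event (suc n))) ⟩
      Prob (event (suc n)) ∎
      where
      open ℚ.≤-Reasoning
      open ℚ-Solver
      large≤L : A ℕ.⊔ threshold ℕ.≤ L n
      large≤L = ℕ.≤-pred (2^-cancel-< (ℕ.≤-<-trans large (proj₂ (proj₂ (floorLog n)))))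
      A≤L : A ℕ.≤ L n
      A≤L = ℕ.m⊔n≤o⇒m≤o A threshold large≤L
      threshold≤L : threshold ℕ.≤ L n
      threshold≤L = ℕ.m⊔n≤o⇒n≤o A threshold large≤L
      room : m n ℕ.* 6 ℕ.≤ suc n
      room = ℕ.≤-trans
        (ℕ.≤-reflexive (thirty (L n) N₀))
        (ℕ.≤-trans (linear≤2^ (ℕ.≤-trans (ℕ.m≤n+m _ 4) threshold≤L) (ℕ.≤-trans (ℕ.m≤m+n 4 _) threshold≤L))
          (proj₁ (proj₂ (floorLog n))))
        where
        thirty : ∀ L N → ((L ℕ.* 5) ℕ.* suc N) ℕ.* 6 ≡ (30 ℕ.* suc N) ℕ.* L
        thirty L N = S.solve 4 (λ a b L M → ((L S.:* a) S.:* M) S.:* b S.:= (a S.:* b S.:* M) S.:* L)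
          refl 5 6 L (suc N)
          where
          module S = ℕ-Solver

-- Convergence of the real probabilities

module _ (p : ℝ) {ε₁ ε₂ : ℚ} {N₁ N₂ : ℕ} (0<ε₁ : 0ℚ < ε₁) (0<ε₂ : 0ℚ < ε₂)
  (ε₁≤p : ∀ k → N₁ ℕ.≤ k → 0ℚ + ε₁ ≤ seq p k) (p+ε₂≤1 : ∀ k → N₂ ℕ.≤ k → seq p k + ε₂ ≤ 1ℚ)
  {N₀ : ℕ} (recip≤δ : recip N₀ ≤ p³q² ε₁ ε₂) where
  open Construction N₀

  module _ (k : ℕ) (N₁≤k : N₁ ℕ.≤ k) (N₂≤k : N₂ ℕ.≤ k) where
    ε₁≤pₖ : ε₁ ≤ seq p k
    ε₁≤pₖ = subst (_≤ seq p k) (ℚ.+-identityˡ ε₁) (ε₁≤p k N₁≤k)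
    0≤pₖ : 0ℚ ≤ seq p k
    0≤pₖ = ℚ.≤-trans (ℚ.<⇒≤ 0<ε₁) ε₁≤pₖ
    pₖ≤1 : seq p k ≤ 1ℚ
    pₖ≤1 = +-nonNeg-cancel-≤ (p+ε₂≤1 k N₂≤k) (ℚ.<⇒≤ 0<ε₂)
    recip≤δₖ : recip N₀ ≤ p³q² (seq p k) (1ℚ - seq p k)
    recip≤δₖ = ℚ.≤-trans recip≤δ
      (p³q²-mono (ℚ.<⇒≤ 0<ε₁) (ℚ.<⇒≤ 0<ε₂) ε₁≤pₖ (+≤1⇒≤1- {seq p k} {ε₂} (p+ε₂≤1 k N₂≤k)))

  module _ (ε : ℝ) {e : ℚ} {Nₑ : ℕ} (0<e : 0ℚ < e) (e≤ε : ∀ k → Nₑ ℕ.≤ k → 0ℚ + e ≤ seq ε k)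
    {A : ℕ} (recip≤e/2 : recip A ≤ ½ * e) where

    N : ℕ
    N = N₁ ℕ.⊔ (N₂ ℕ.⊔ Nₑ)
    N₁≤ : ∀ {k} → N ℕ.≤ k → N₁ ℕ.≤ k
    N₁≤ = ℕ.m⊔n≤o⇒m≤o N₁ _
    N₂≤ : ∀ {k} → N ℕ.≤ k → N₂ ℕ.≤ k
    N₂≤ = ℕ.m⊔n≤o⇒m≤o N₂ Nₑ ∘ ℕ.m⊔n≤o⇒n≤o N₁ _
    e≤εₖ : ∀ {k} → N ℕ.≤ k → e ≤ seq ε k
    e≤εₖ {k} N≤k = subst (_≤ seq ε k) (ℚ.+-identityˡ e)
      (e≤ε k (ℕ.m⊔n≤o⇒n≤o N₂ Nₑ (ℕ.m⊔n≤o⇒n≤o N₁ _ N≤k)))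

    -- The lower bound on n is independent of k. In the lower estimate one half of `e` covers the
    -- failure probability and the other is the gap that `<ᴿ` demands; above, a probability is at
    -- most 1 and all of `e` is the gap.
    near : ∀ n → 2 ^ (A ℕ.⊔ threshold) ℕ.≤ n →
      (1ᴿ -ᴿ ε <ᴿ Pr p (event n)) × (Pr p (event n) <ᴿ 1ᴿ +ᴿ ε)
    near zero    large = contradiction large (ℕ.<⇒≱ (ℕ.m^n>0 2 (A ℕ.⊔ threshold)))
    near (suc n) large = (½ * e , half-pos 0<e , N , above) , (e , 0<e , N , below)
      where
      open ℚ.≤-Reasoning
      open ℚ-Solver
      above : ∀ k → N ℕ.≤ k → 1ℚ - seq ε k + ½ * e ≤ seq (Pr p (event (suc n))) k
      above k N≤k = begin
        1ℚ - seq ε k + ½ * e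
          ≤⟨ ℚ.+-monoˡ-≤ (½ * e) (1-antimono (e≤εₖ N≤k)) ⟩
        1ℚ - e + ½ * e
          ≡⟨ solve 1 (λ e → con 1ℚ :- e :+ con ½ :* e := con 1ℚ :- con ½ :* e) refl e ⟩
        1ℚ - ½ * e
          ≤⟨ 1-antimono recip≤e/2 ⟩
        1ℚ - recip A
          ≤⟨ Prob-event (0≤pₖ k (N₁≤ N≤k) (N₂≤ N≤k)) (pₖ≤1 k (N₁≤ N≤k) (N₂≤ N≤k))
                                      (recip≤δₖ k (N₁≤ N≤k) (N₂≤ N≤k)) n A large ⟩
        Prob (event (suc n))
          ≡⟨ seq-Pr p k (event (suc n)) ⟨
        seq (Pr p (event (suc n))) k ∎
        where
        open Expectation (seq p k)
      below : ∀ k → N ℕ.≤ k → seq (Pr p (event (suc n))) k + e ≤ 1ℚ + seq ε k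
      below k N≤k = ℚ.+-mono-≤
        (subst (_≤ 1ℚ) (sym (seq-Pr p k (event (suc n))))
          (Expectation.Prob-≤1 (seq p k) (0≤pₖ k (N₁≤ N≤k) (N₂≤ N≤k)) (pₖ≤1 k (N₁≤ N≤k) (N₂≤ N≤k)) (event (suc n))))
        (e≤εₖ N≤k)

  event-aas : (λ n → Pr p (event n)) ⟶ 1ᴿ
  event-aas ε (e , 0<e , Nₑ , e≤ε) =
    let A , recip≤e/2 = archimedean (½ * e) (half-pos 0<e)
    in 2 ^ (A ℕ.⊔ threshold) , near ε 0<e e≤ε recip≤e/2

  queryOrder-aas : AAS p QueryOrder
  queryOrder-aas = event , event⇒order , event-aas

corollary1p3 : (p : ℝ) → 0ᴿ <ᴿ p → p <ᴿ 1ᴿ →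
    Σ[ c₁ ∈ ℝ ] Σ[ C₁ ∈ ℝ ] Σ[ c₂ ∈ ℝ ] Σ[ C₂ ∈ ℝ ]
    (0ᴿ <ᴿ c₁) × (0ᴿ <ᴿ C₁) × (0ᴿ <ᴿ c₂) × (0ᴿ <ᴿ C₂) ×
    AAS p (λ n G →
    Σ[ pq ∈ ℕ ] Σ[ eq ∈ ℕ ]
    IsPq G pq × IsEq G eq ×
    Between c₁ C₁ (fromℕ eq) (fromℕ pq) ×
    Between c₂ C₂ (log n) (fromℕ eq))
corollary1p3 p (ε₁ , 0<ε₁ , _ , ε₁≤p) (ε₂ , 0<ε₂ , _ , p+ε₂≤1) =
  fromℚ (recip d) , 1ᴿ , 1ᴿ , fromℕ (D ℕ.+ D) ,
  0<fromℚ (recip-pos d) , 0<fromℚ (ℚ.positive⁻¹ 1ℚ) ,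
  0<fromℚ (ℚ.positive⁻¹ 1ℚ) , 0<fromℚ (ℚ.positive⁻¹ (fromℕℚ (D ℕ.+ D))) ,
  queryOrder-aas p 0<ε₁ 0<ε₂ ε₁≤p p+ε₂≤1 (proj₂ rate)
  where
  rate : ∃[ N₀ ] recip N₀ ≤ p³q² ε₁ ε₂
  rate = archimedean (p³q² ε₁ ε₂) (p³q²-pos 0<ε₁ 0<ε₂)
  N₀ : ℕ
  N₀ = proj₁ rate
  open Construction N₀
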